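{- Let $q$ be an odd prime power, let $d\ge2$, let $Q$ be a nondegenerate quadratic form on $\mathbb F_q^d$, let $P\subseteq\mathbb F_q^d$ be nonempty and let $T\subseteq\mathbb F_q^d$ be a set of $m\ge2$ pins. Suppose $$|\Delta_p^Q(P)|\le(1-\alpha)q\qquad(p\in T)$$ for some $0<\alpha<1$, and suppose that for some $C_1\ge1$, $$(1-\alpha)^3mq^3\le C_1^2\alpha^2|P|.$$ Then there exist distinct pins $p,p'\in T$ and attained radii $t\in\Delta_p^Q(P)$, $t'\in\Delta_{p'}^Q(P)$ for which $$|P\cap S_Q(p,t)\cap S_Q(p',t')|\ge\frac{\alpha}{8C_1\sqrt{1-\alpha}}\sqrt{\frac{m|P|}q}.\tag{*}$$ The same lower bound holds for $|P\cap H|$, where $H$ is the corresponding radical hyperplane of $S_Q(p,t)$ and $S_Q(p',t')$. Moreover, at least $$\frac{3|P|m(m-1)}{4q^{d-1}}$$ ordered choices $((p,t),(p',t'))$ (with $p\ne p'$ in $T$, $t\in\Delta_p^Q(P)$, $t'\in\Delta_{p'}^Q(P)$) satisfy (*); if $d\ge3$, the lower bound improves to $$\frac{3|P|m(m-1)}{8q^{d-2}}.$$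
   Context: $\Delta_p^Q(P)=\{Q(x-p):x\in P\}$ and $S_Q(c,r)=\{x\in\mathbb F_q^d:Q(x-c)=r\}$. With $\langle x,y\rangle_Q=\frac{Q(x+y)-Q(x)-Q(y)}2$, the radical hyperplane of $S_Q(c,r)$ and $S_Q(c',r')$, $c\ne c'$, is $\{x\in\mathbb F_q^d:2\langle c'-c,x\rangle_Q=(r-r')-Q(c)+Q(c')\}$. -}

module Defs where

open import Level using (_⊔_) renaming (suc to lsuc)
open import Algebra.Apartness.Bundles using (HeytingField)
open import Algebra.Bundles using (CommutativeRing; Semiring)
import Algebra.Definitions.RawSemiring as RawSemiringDefs
open import Algebra.Structures using (IsCommutativeRing)
open import Data.Fin.Base using (Fin)
open import Data.Fin.Properties using (nonZeroIndex)
import Data.Fin.Properties as Fin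
open import Data.List.Base using (List; length; filter; map; deduplicate)
import Data.List.Membership.Propositional as List∈
open import Data.List.Relation.Unary.Unique.Propositional using (Unique)
open import Data.List.Relation.Unary.Unique.Propositional.Properties using (filter⁺)
import Data.List.Relation.Unary.Unique.DecPropositional.Properties as DecUnique
open import Data.Nat.Base as ℕ using (ℕ; zero; suc; NonZero)
open import Data.Nat.Primality using (Prime)
open import Data.Product.Base using (_×_; _,_; proj₁; ∃-syntax)
open import Data.Sum.Base using (_⊎_; inj₁; inj₂)
open import Data.Vec.Base as Vec using (Vec; zipWith; replicate)
open import Function.Bundles using (_↔_; Inverse)
open import Function.Properties.Inverse using (↔⇒↣)
open import Relation.Binary.Core using (Rel)
open import Relation.Binary.Definitions using (DecidableEquality)
open import Relation.Binary.PropositionalEquality.Core using (_≡_; _≢_)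
open import Relation.Binary.Structures using (IsStrictPartialOrder)
open import Relation.Nullary.Decidable using (via-injection)
open import Relation.Nullary.Negation using (¬_; contradiction)
open import Relation.Unary using (Pred; Decidable)

OddPrimePower : ℕ → Set
OddPrimePower q = ∃[ p ] ∃[ k ] Prime p × p ≢ 2 × 1 ℕ.≤ k × q ≡ p ℕ.^ k

-- A finite set is represented by a duplicate-free list of its elements.
record Finset {a} (A : Set a) : Set a where
  constructor ⟪_,_⟫
  field
    elements : List A
    distinct : Unique elements

open Finset public

module _ {a} {A : Set a} where

  infix 4 _∈_

  _∈_ : A → Finset A → Set a
  x ∈ X = x List∈.∈ elements X

  ∣_∣ : Finset A → ℕ
  ∣ X ∣ = length (elements X)

  Nonempty : Finset A → Set a
  Nonempty X = ∃[ x ] x ∈ X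

  infixl 7 _∩[_]

  _∩[_] : ∀ {p} {B : Pred A p} → Finset A → Decidable B → Finset A
  X ∩[ B? ] = ⟪ filter B? (elements X) , filter⁺ B? (distinct X) ⟫

image : ∀ {a b} {A : Set a} {B : Set b} →
        DecidableEquality B → (A → B) → Finset A → Finset B
image _≟_ f X = ⟪ deduplicate _≟_ ys , DecUnique.deduplicate-! _≟_ ys ⟫
  where ys = map f (elements X)

-- The real numbers, characterised axiomatically as a Cauchy-complete
-- Archimedean ordered field.  Classically this determines ℝ up to unique
-- isomorphism; apartness and the negative definition of ≤ avoid assuming
-- that the order is decidable, so the axioms also hold constructively.
record RealNumbers c ℓ₁ ℓ₂ ℓ₃ : Set (lsuc (c ⊔ ℓ₁ ⊔ ℓ₂ ⊔ ℓ₃)) where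
  infix 4 _<_ _≤_
  field
    heytingField : HeytingField c ℓ₁ ℓ₂

  open HeytingField heytingField public

  commutativeRing : CommutativeRing c ℓ₁
  commutativeRing = record { isCommutativeRing = isCommutativeRing }

  open CommutativeRing commutativeRing public using (semiring; ring)

  infixr 8 _^_

  _^_ : Carrier → ℕ → Carrier
  _^_ = RawSemiringDefs._^_ (Semiring.rawSemiring semiring)

  ι : ℕ → Carrier
  ι n = RawSemiringDefs._×_ (Semiring.rawSemiring semiring) n 1#

  field
    _<_                    : Rel Carrier ℓ₃
    <-isStrictPartialOrder : IsStrictPartialOrder _≈_ _<_
    #⇒<⊎>                  : ∀ {x y} → x # y → x < y ⊎ y < x
    <⇒#                    : ∀ {x y} → x < y → x # y
    +-monoˡ-<              : ∀ {x y} z → x < y → x + z < y + z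
    *-pos                  : ∀ {x y} → 0# < x → 0# < y → 0# < x * y
    archimedean            : ∀ x → ∃[ n ] x < ι n

  _≤_ : Rel Carrier ℓ₃
  x ≤ y = ¬ (y < x)

  Within : Carrier → Rel Carrier ℓ₃
  Within ε x y = x - y < ε × y - x < ε

  Cauchy : (ℕ → Carrier) → Set (c ⊔ ℓ₃)
  Cauchy u = ∀ ε → 0# < ε → ∃[ N ] ∀ m n → N ℕ.≤ m → N ℕ.≤ n → Within ε (u m) (u n)

  _⟶_ : (ℕ → Carrier) → Carrier → Set (c ⊔ ℓ₃)
  u ⟶ l = ∀ ε → 0# < ε → ∃[ N ] ∀ n → N ℕ.≤ n → Within ε (u n) l

  field
    complete : ∀ u → Cauchy u → ∃[ l ] u ⟶ l

    -- Square roots exist by completeness; they are named here for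
    -- convenience.  No value is prescribed at negative arguments
    -- (x ↦ √ (max 0 x) is a total choice that needs no case distinction).
    √_  : Carrier → Carrier
    0≤√ : ∀ x → 0# ≤ √ x
    √²  : ∀ {x} → 0# ≤ x → √ x * √ x ≈ x

  infix 9 √_

  infixl 7 _/_[_]

  _/_[_] : (x y : Carrier) → y # 0# → Carrier
  x / y [ y#0 ] = x * proj₁ (#⇒invertible y#0)

module RealLemmas {c ℓ₁ ℓ₂ ℓ₃} (ℝ : RealNumbers c ℓ₁ ℓ₂ ℓ₃) where
  open RealNumbers ℝ
  open import Algebra.Apartness.Properties.HeytingCommutativeRing heytingCommutativeRing
    using (1#0; x#0y#0→xy#0; #-congʳ; x-0≈x; invertibleˡ⇒#)
  open import Algebra.Properties.Ring ring using (-1*x≈-x; -‿involutive)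
  private
    module < = IsStrictPartialOrder <-isStrictPartialOrder
    open import Relation.Binary.Reasoning.Setoid
      (CommutativeRing.setoid commutativeRing)

  0<⇒#0 : ∀ {x} → 0# < x → x # 0#
  0<⇒#0 0<x = #-sym (<⇒# 0<x)

  0<1 : 0# < 1#
  0<1 with #⇒<⊎> 1#0
  ... | inj₂ 0<1 = 0<1
  ... | inj₁ 1<0 = <.<-respʳ-≈ [-1]²≈1 (*-pos 0<-1 0<-1)
    where
    0<-1 : 0# < - 1#
    0<-1 = <.<-respˡ-≈ (-‿inverseʳ 1#)
             (<.<-respʳ-≈ (+-identityˡ (- 1#)) (+-monoˡ-< (- 1#) 1<0))
    [-1]²≈1 : - 1# * - 1# ≈ 1#
    [-1]²≈1 = trans (-1*x≈-x (- 1#)) (-‿involutive 1#)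

  +-pos : ∀ {x y} → 0# < x → 0# < y → 0# < x + y
  +-pos {x} {y} 0<x 0<y =
    <.trans 0<y (<.<-respˡ-≈ (+-identityˡ y) (+-monoˡ-< y 0<x))

  ι-pos : ∀ n → .{{NonZero n}} → 0# < ι n
  ι-pos (suc zero)      = <.<-respʳ-≈ (sym (+-identityʳ 1#)) 0<1
  ι-pos (suc n@(suc _)) = +-pos 0<1 (ι-pos n)

  ι#0 : ∀ n → .{{NonZero n}} → ι n # 0#
  ι#0 n = 0<⇒#0 (ι-pos n)

  1≤⇒#0 : ∀ {x} → 1# ≤ x → x # 0#
  1≤⇒#0 {x} 1≤x with #-cotrans 1#0 x
  ... | inj₂ x#0 = x#0
  ... | inj₁ 1#x with #⇒<⊎> 1#x
  ...   | inj₁ 1<x = 0<⇒#0 (<.trans 0<1 1<x)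
  ...   | inj₂ x<1 = contradiction x<1 1≤x

  √#0 : ∀ {x} → 0# < x → √ x # 0#
  √#0 {x} 0<x with #⇒invertible (#-congʳ (sym (√² λ x<0 → <.irrefl refl (<.trans 0<x x<0))) (0<⇒#0 0<x))
  ... | z , z*[√x*√x-0]≈1 , _ = invertibleˡ⇒# (z * √ x , (begin
    z * √ x * (√ x - 0#)   ≈⟨ *-congˡ (x-0≈x (√ x)) ⟩
    z * √ x * √ x          ≈⟨ *-assoc z (√ x) (√ x) ⟩
    z * (√ x * √ x)        ≈⟨ *-congˡ (x-0≈x (√ x * √ x)) ⟨
    z * (√ x * √ x - 0#)   ≈⟨ z*[√x*√x-0]≈1 ⟩
    1#                     ∎))

  8C√[1-α]#0 : ∀ {α C} → α < 1# → 1# ≤ C → ι 8 * C * √ (1# - α) # 0#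
  8C√[1-α]#0 {α} α<1 1≤C =
    x#0y#0→xy#0 (x#0y#0→xy#0 (ι#0 8) (1≤⇒#0 1≤C))
      (√#0 (<.<-respˡ-≈ (-‿inverseʳ α) (+-monoˡ-< (- α) α<1)))

  -- "At least b elements satisfy B", for a real number b.
  AtLeast : ∀ {a p} {A : Set a} → Carrier → Pred A p → Set _
  AtLeast b B = ∃[ G ] (∀ x → x ∈ G → B x) × b ≤ ι ∣ G ∣

-- Equality is propositional.  The inverse is a total function with an
-- unspecified value at 0#.
record FiniteField (q : ℕ) : Set₁ where
  infix  8 -_
  infixl 7 _*_
  infixl 6 _+_ _-_
  infix  9 _⁻¹
  field
    Carrier           : Set
    _+_ _*_           : Carrier → Carrier → Carrier
    -_                : Carrier → Carrier
    0# 1#             : Carrier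
    isCommutativeRing : IsCommutativeRing _≡_ _+_ _*_ -_ 0# 1#
    0≢1               : 0# ≢ 1#
    _⁻¹               : Carrier → Carrier
    ⁻¹-inverseʳ       : ∀ x → x ≢ 0# → x * x ⁻¹ ≡ 1#
    enumeration       : Carrier ↔ Fin q

  _-_ : Carrier → Carrier → Carrier
  x - y = x + - y

  2# : Carrier
  2# = 1# + 1#

  infix 4 _≟_

  _≟_ : DecidableEquality Carrier
  _≟_ = via-injection (↔⇒↣ enumeration) Fin._≟_

  q≢0 : NonZero q
  q≢0 = nonZeroIndex (Inverse.to enumeration 0#)

module Geometry {q : ℕ} (𝔽 : FiniteField q) (d : ℕ) where
  private module 𝔽 = FiniteField 𝔽
  open FiniteField 𝔽 using (2#; 0#; _⁻¹; _≟_)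

  Scalar Point : Set
  Scalar = 𝔽.Carrier
  Point  = Vec Scalar d

  infixl 6 _+ᵥ_ _-ᵥ_
  infixr 7 _*ᵥ_

  0ᵥ : Point
  0ᵥ = replicate d 0#

  _+ᵥ_ _-ᵥ_ : Point → Point → Point
  _+ᵥ_ = zipWith 𝔽._+_
  _-ᵥ_ = zipWith 𝔽._-_

  _*ᵥ_ : Scalar → Point → Point
  a *ᵥ x = Vec.map (a 𝔽.*_) x

  module _ (Q : Point → Scalar) where

    ⟨_,_⟩ : Point → Point → Scalar
    ⟨ x , y ⟩ = (Q (x +ᵥ y) 𝔽.- Q x 𝔽.- Q y) 𝔽.* 2# ⁻¹

    -- The polar form divides by 2#, which is nonzero when q is odd.
    -- Bilinearity needs to be required in one argument only, since ⟨_,_⟩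
    -- is symmetric.
    record IsQuadraticForm : Set where
      field
        homogeneous : ∀ a x → Q (a *ᵥ x) ≡ (a 𝔽.* a) 𝔽.* Q x
        additive    : ∀ x y z → ⟨ x +ᵥ y , z ⟩ ≡ ⟨ x , z ⟩ 𝔽.+ ⟨ y , z ⟩
        scaling     : ∀ a x y → ⟨ a *ᵥ x , y ⟩ ≡ a 𝔽.* ⟨ x , y ⟩

    Nondegenerate : Set
    Nondegenerate = ∀ x → (∀ y → ⟨ x , y ⟩ ≡ 0#) → x ≡ 0ᵥ

    Δ : Point → Finset Point → Finset Scalar
    Δ p P = image _≟_ (λ x → Q (x -ᵥ p)) P

    Sphere : Point → Scalar → Pred Point _
    Sphere c r x = Q (x -ᵥ c) ≡ r

    S : ∀ c r → Decidable (Sphere c r)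
    S c r x = Q (x -ᵥ c) ≟ r

    RadicalHyperplane : (c : Point) (r : Scalar) (c′ : Point) (r′ : Scalar) → Pred Point _
    RadicalHyperplane c r c′ r′ x =
      2# 𝔽.* ⟨ c′ -ᵥ c , x ⟩ ≡ (r 𝔽.- r′) 𝔽.- Q c 𝔽.+ Q c′

    H : ∀ c r c′ r′ → Decidable (RadicalHyperplane c r c′ r′)
    H c r c′ r′ x = 2# 𝔽.* ⟨ c′ -ᵥ c , x ⟩ ≟ (r 𝔽.- r′) 𝔽.- Q c 𝔽.+ Q c′

    Choice : Set
    Choice = (Point × Scalar) × (Point × Scalar)

    Admissible : (P T : Finset Point) → Pred Choice _
    Admissible P T ((p , t) , (p′ , t′)) =
      p ∈ T × p′ ∈ T × p ≢ p′ × t ∈ Δ p P × t′ ∈ Δ p′ P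

{-# OPTIONS --safe #-}
module Submission where

-- Write β = 1 − α.  The hypothesis relating m, q and |P| makes the bound (*) at most
-- (α² / 8) · |P| / (β q)², less than an eighth of the average size of a cell P ∩ S(p,t) ∩ S(p′,t′),
-- since each pin sees at most β q radii.  For fixed p ≠ p′ the cells below an eighth of the average cover
-- at most |P| / 8 points, so the others cover at least 7|P| / 8.  A cell lies on the radical hyperplane
-- and so has at most q^(d-1) points.  If d ≥ 3, then u^⊥ (u = p′ − p) is not totally isotropic; projecting
-- along some v ∈ u^⊥ with Q v ≠ 0 is at most two-to-one on a cell, which therefore has at most 2 q^(d-2)
-- points.  Dividing 7|P| / 8 by these sizes counts the rich choices.
--
-- The order of the reals is not decidable, so the rich choices are selected by comparing natural
-- numbers: |P| ≤ 8 |Δ_p| |Δ_p′| · |cell|.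

open import Defs
open import Algebra.Bundles using (CommutativeRing)
import Algebra.Properties.CommutativeMonoid.Sum as CommutativeMonoidSum
import Algebra.Properties.CommutativeSemigroup as CommutativeSemigroupProperties
import Algebra.Properties.Group as GroupProperties
import Algebra.Properties.Ring as RingProperties
import Algebra.Properties.Semiring.Mult as SemiringMult
import Algebra.Properties.Semiring.Mult.TCOptimised as SemiringMultOptimised
import Algebra.Solver.Ring as RingSolver
open import Algebra.Solver.Ring.AlmostCommutativeRing
  using (_-Raw-AlmostCommutative⟶_; fromCommutativeRing)
open import Data.Fin.Base using (Fin; zero; suc; combine; remQuot)
open import Data.Fin.Permutation using (permutation)
import Data.Fin.Properties as Fin
open import Data.Integer.Base as ℤ using (ℤ; 1ℤ)
import Data.Integer.Properties as ℤ
open import Data.List.Base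
  using (List; []; _∷_; length; map; filter; allFin; concatMap; cartesianProduct)
open import Data.List.Membership.Propositional using (find; lose) renaming (_∈_ to _∈ˡ_)
open import Data.List.Membership.Propositional.Properties
  using (∈-filter⁻; ∈-allFin; ∈-map⁺; ∈-map⁻; ∈-concatMap⁻; ∈-cartesianProduct⁺; ∈-cartesianProduct⁻;
         ∈-deduplicate⁺; ∈-length)
open import Data.List.Properties using (filter-accept; filter-all; length-++; length-map; length-tabulate)
open import Data.List.Relation.Binary.Sublist.Propositional using (⊆-refl)
import Data.List.Relation.Binary.Sublist.Propositional.Properties as Sublist
open import Data.List.Relation.Unary.All using (_∷_)
open import Data.List.Relation.Unary.All.Properties using (All¬⇒¬Any)
open import Data.List.Relation.Unary.AllPairs using ([]; _∷_)
open import Data.List.Relation.Unary.Any as Any using (Any; here; there)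
open import Data.List.Relation.Unary.Unique.Propositional using (Unique)
import Data.List.Relation.Unary.Unique.Propositional.Properties as Unique
open import Data.Maybe.Base using (Maybe; just; nothing)
open import Data.Nat.Base as ℕ using (ℕ; zero; suc; z≤n; s≤s; NonZero)
open import Data.Nat.Divisibility using (_∣_; ∣1⇒≡1; m%n≡0⇒n∣m)
open import Data.Nat.DivMod using (_%_; _/_; m≡m%n+[m/n]*n; m%n<n)
import Data.Nat.ListAction as ListAction
open import Data.Nat.Primality using (euclidsLemma; prime⇒irreducible; prime[2])
import Data.Nat.Properties as ℕ
open import Data.Nat.Properties using (m*n≢0; m^n≢0)
open import Data.Nat.Tactic.RingSolver using (solve-∀)
open import Data.Product.Base using (_×_; _,_; proj₁; proj₂; ∃-syntax)
open import Data.Sum.Base using (_⊎_; inj₁; inj₂; [_,_]′)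
open import Data.Vec.Base using (Vec; []; _∷_)
import Data.Vec.Properties as Vec
open import Function.Base using (_∘_; id)
open import Function.Bundles using (Injection; Inverse; _↔_; mk↔ₛ′)
open import Function.Properties.Inverse using (↔⇒↣; ↔-sym)
open import Relation.Binary.Definitions using (DecidableEquality)
open import Relation.Binary.PropositionalEquality as ≡ using (_≡_; _≢_)
import Relation.Binary.Reasoning.Setoid as SetoidReasoning
open import Relation.Binary.Structures using (IsStrictPartialOrder)
open import Relation.Nullary.Decidable using (yes; no; decidable-stable; _×-dec_; ¬?)
open import Relation.Nullary.Negation using (¬_; contradiction)
open import Relation.Unary using (Pred; Decidable)

-- The average is taken over all pairs of attained radii, those with an empty cell included, because
-- the number of these pairs is what the hypothesis on the pins controls. Lowering 7/8 to 6/8 gives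
-- the constant 3/4, and for d ≥ 3 the factor 2 in the cell size halves it. One set of choices
-- serves all three conclusions.
--
-- A vector w with ⟨u, w⟩ ≠ 0 and a vector v ∈ u^⊥ with Q v ≠ 0 are never constructed. They exist up
-- to double negation, which is enough because the bounds on cells are decidable inequalities
-- between natural numbers.
--
-- Cardinalities take the place of dimensions. A radical hyperplane is a level set of ⟨u, ·⟩, so
-- projection along w is injective on it, and for d ≥ 3 the projection along v is applied after this
-- one. If u^⊥ were totally isotropic, u and w would span the space, so that q^d ≤ q^2.

module IntegerCoefficientSolver {c ℓ} (R : CommutativeRing c ℓ) where
  open import Data.Integer.Base using (+_; -[1+_])
  open CommutativeRing R
  open RingProperties ring using (-‿+-comm; -‿involutive; -0#≈0#; -‿distribˡ-*; -‿distribʳ-*)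
  open CommutativeSemigroupProperties +-commutativeSemigroup using (interchange)
  open SemiringMultOptimised semiring using (1+×; ×-homo-+; ×1-homo-*) renaming (_×_ to _·_)
  open SetoidReasoning setoid

  private
    -- Coefficients are integers because equality in `R` need not be decidable. The optimised
    -- multiple makes 0 and 1 evaluate to `0#` and `1#` by definition, so `con 1ℤ` matches a literal
    -- one in a goal.
    ⟦_⟧ : ℤ → Carrier
    ⟦ + n ⟧      = n · 1#
    ⟦ -[1+ n ] ⟧ = - (suc n · 1#)

    -‿homo : ∀ i → ⟦ ℤ.- i ⟧ ≈ - ⟦ i ⟧
    -‿homo (+ zero)   = sym -0#≈0#
    -‿homo (+ suc n)  = refl
    -‿homo -[1+ n ]   = sym (-‿involutive _)

    ⊖-homo : ∀ m n → ⟦ m ℤ.⊖ n ⟧ ≈ m · 1# - n · 1#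
    ⊖-homo m       zero    = sym (trans (+-congˡ -0#≈0#) (+-identityʳ _))
    ⊖-homo zero    (suc n) = sym (+-identityˡ _)
    ⊖-homo (suc m) (suc n) = begin
      ⟦ suc m ℤ.⊖ suc n ⟧                  ≡⟨ ≡.cong ⟦_⟧ (ℤ.[1+m]⊖[1+n]≡m⊖n m n) ⟩
      ⟦ m ℤ.⊖ n ⟧                          ≈⟨ ⊖-homo m n ⟩
      m · 1# - n · 1#                      ≈⟨ +-identityˡ _ ⟨
      0# + (m · 1# - n · 1#)               ≈⟨ +-congʳ (-‿inverseʳ 1#) ⟨
      1# - 1# + (m · 1# - n · 1#)          ≈⟨ interchange 1# (- 1#) (m · 1#) (- (n · 1#)) ⟩
      1# + m · 1# + (- 1# - n · 1#)        ≈⟨ +-congˡ (-‿+-comm 1# (n · 1#)) ⟩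
      1# + m · 1# - (1# + n · 1#)          ≈⟨ +-cong (1+× m 1#) (-‿cong (1+× n 1#)) ⟨
      suc m · 1# - suc n · 1#              ∎

    +-homo : ∀ i j → ⟦ i ℤ.+ j ⟧ ≈ ⟦ i ⟧ + ⟦ j ⟧
    +-homo (+ m)    (+ n)    = ×-homo-+ 1# m n
    +-homo (+ m)    -[1+ n ] = ⊖-homo m (suc n)
    +-homo -[1+ m ] (+ n)    = trans (⊖-homo n (suc m)) (+-comm _ _)
    +-homo -[1+ m ] -[1+ n ] = begin
      ⟦ -[1+ m ] ℤ.+ -[1+ n ] ⟧            ≡⟨ ≡.cong ⟦_⟧ (ℤ.neg-distrib-+ (+ suc m) (+ suc n)) ⟨
      - ((suc m ℕ.+ suc n) · 1#)           ≈⟨ -‿cong (×-homo-+ 1# (suc m) (suc n)) ⟩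
      - (suc m · 1# + suc n · 1#)          ≈⟨ -‿+-comm _ _ ⟨
      - (suc m · 1#) - suc n · 1#          ∎

    +*-homo : ∀ m j → ⟦ + m ℤ.* j ⟧ ≈ ⟦ + m ⟧ * ⟦ j ⟧
    +*-homo m (+ n)    = trans (reflexive (≡.cong ⟦_⟧ (≡.sym (ℤ.pos-* m n)))) (×1-homo-* m n)
    +*-homo m -[1+ n ] = begin
      ⟦ + m ℤ.* -[1+ n ] ⟧                 ≡⟨ ≡.cong ⟦_⟧ (ℤ.neg-distribʳ-* (+ m) (+ suc n)) ⟨
      ⟦ ℤ.- (+ m ℤ.* + suc n) ⟧            ≈⟨ -‿homo (+ m ℤ.* + suc n) ⟩
      - ⟦ + m ℤ.* + suc n ⟧                ≈⟨ -‿cong (+*-homo m (+ suc n)) ⟩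
      - (m · 1# * (suc n · 1#))              ≈⟨ -‿distribʳ-* _ _ ⟩
      m · 1# * - (suc n · 1#)              ∎

    *-homo : ∀ i j → ⟦ i ℤ.* j ⟧ ≈ ⟦ i ⟧ * ⟦ j ⟧
    *-homo (+ m)    j = +*-homo m j
    *-homo -[1+ m ] j = begin
      ⟦ -[1+ m ] ℤ.* j ⟧                   ≡⟨ ≡.cong ⟦_⟧ (ℤ.neg-distribˡ-* (+ suc m) j) ⟨
      ⟦ ℤ.- (+ suc m ℤ.* j) ⟧              ≈⟨ -‿homo (+ suc m ℤ.* j) ⟩
      - ⟦ + suc m ℤ.* j ⟧                  ≈⟨ -‿cong (+*-homo (suc m) j) ⟩
      - (suc m · 1# * ⟦ j ⟧)               ≈⟨ -‿distribˡ-* _ _ ⟩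
      - (suc m · 1#) * ⟦ j ⟧               ∎

    homomorphism : ℤ.+-*-rawRing -Raw-AlmostCommutative⟶ fromCommutativeRing R
    homomorphism = record
      { ⟦_⟧ = ⟦_⟧; +-homo = +-homo; *-homo = *-homo; -‿homo = -‿homo; 0-homo = refl; 1-homo = refl }

    -- In positive characteristic distinct integers can have equal images, so a failed comparison
    -- yields `nothing` and not a refutation.
    ⟦_⟧≟⟦_⟧ : ∀ i j → Maybe (⟦ i ⟧ ≈ ⟦ j ⟧)
    ⟦ i ⟧≟⟦ j ⟧ with i ℤ.≟ j
    ... | yes i≡j = just (reflexive (≡.cong ⟦_⟧ i≡j))
    ... | no  _   = nothing

  open RingSolver ℤ.+-*-rawRing (fromCommutativeRing R) homomorphism ⟦_⟧≟⟦_⟧ public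
    using (solve; _:=_; _:+_; _:*_; _:-_; :-_; con)

-- Double counting on lists, and cells of at least an eighth of the average size

module Counting where

  open import Data.Nat.Base using (_+_; _*_; _≤_; _<_)
  open import Data.Nat.Properties
  open ListAction using (sum)
  open ≡ using (refl; sym; trans; cong; cong₂; subst)

  module _ {a} {A : Set a} where

    sum-map-mono-≤ : ∀ {f g : A → ℕ} → (∀ x → f x ≤ g x) → ∀ xs → sum (map f xs) ≤ sum (map g xs)
    sum-map-mono-≤ f≤g []       = z≤n
    sum-map-mono-≤ f≤g (x ∷ xs) = +-mono-≤ (f≤g x) (sum-map-mono-≤ f≤g xs)

    sum-map-mono-< : ∀ {f g : A → ℕ} → (∀ x → f x ≤ g x) → ∀ {xs} →
      Any (λ x → f x < g x) xs → sum (map f xs) < sum (map g xs)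
    sum-map-mono-< f≤g {_ ∷ xs} (here fx<gx) = +-mono-<-≤ fx<gx (sum-map-mono-≤ f≤g xs)
    sum-map-mono-< f≤g          (there p)    = +-mono-≤-< (f≤g _) (sum-map-mono-< f≤g p)

    sum-map-≤ : ∀ {f : A → ℕ} {k} → (∀ x → f x ≤ k) → ∀ xs → sum (map f xs) ≤ length xs * k
    sum-map-≤ f≤k []       = z≤n
    sum-map-≤ f≤k (x ∷ xs) = +-mono-≤ (f≤k x) (sum-map-≤ f≤k xs)

  module _ {a} {A : Set a} where

    length-filter-mono : ∀ {p r} {P : Pred A p} {R : Pred A r} (P? : Decidable P) (R? : Decidable R) →
      (∀ {x} → P x → R x) → ∀ xs → length (filter P? xs) ≤ length (filter R? xs)
    length-filter-mono P? R? P⇒R xs =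
      Sublist.length-mono-≤ (Sublist.filter⁺ P? R? (λ { refl → P⇒R }) (⊆-refl {x = xs}))

    filter-filter : ∀ {p r} {P : Pred A p} {R : Pred A r} (P? : Decidable P) (R? : Decidable R) →
      ∀ xs → filter R? (filter P? xs) ≡ filter (λ x → P? x ×-dec R? x) xs
    filter-filter P? R? [] = refl
    filter-filter P? R? (x ∷ xs) with P? x
    ... | no  _ = filter-filter P? R? xs
    ... | yes _ with R? x
    ...   | yes _ = cong (x ∷_) (filter-filter P? R? xs)
    ...   | no  _ = filter-filter P? R? xs

    unique-length≤1 : ∀ {xs : List A} → Unique xs → (∀ {x y} → x ∈ˡ xs → y ∈ˡ xs → x ≡ y) → length xs ≤ 1
    unique-length≤1 {[]}         _              _  = z≤n
    unique-length≤1 {x ∷ []}     _              _  = s≤s z≤n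
    unique-length≤1 {x ∷ y ∷ xs} ((x≢y ∷ _) ∷ _) eq =
      contradiction (eq (here refl) (there (here refl))) x≢y

    unique-length≤2 : ∀ {xs : List A} → Unique xs →
      (∀ {x y z} → x ∈ˡ xs → y ∈ˡ xs → z ∈ˡ xs → x ≡ y ⊎ x ≡ z ⊎ y ≡ z) → length xs ≤ 2
    unique-length≤2 {[]}             _ _ = z≤n
    unique-length≤2 {x ∷ []}         _ _ = s≤s z≤n
    unique-length≤2 {x ∷ y ∷ []}     _ _ = s≤s (s≤s z≤n)
    unique-length≤2 {x ∷ y ∷ z ∷ xs} ((x≢y ∷ x≢z ∷ _) ∷ (y≢z ∷ _) ∷ _) eq
      with eq (here refl) (there (here refl)) (there (there (here refl)))
    ... | inj₁ x≡y        = contradiction x≡y x≢y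
    ... | inj₂ (inj₁ x≡z) = contradiction x≡z x≢z
    ... | inj₂ (inj₂ y≡z) = contradiction y≡z y≢z

    module _ {b r} {B : Set b} {R : B → A → Set r} (R? : ∀ y → Decidable (R y)) where

      -- Each new entry of the list lengthens at least one of the filtered lists and shortens none.
      length≤sum-filters : ∀ (ys : List B) (xs : List A) → (∀ {x} → x ∈ˡ xs → Any (λ y → R y x) ys) →
        length xs ≤ sum (map (λ y → length (filter (R? y) xs)) ys)
      length≤sum-filters ys []       _     = z≤n
      length≤sum-filters ys (x ∷ xs) cover =
        ≤-<-trans (length≤sum-filters ys xs (cover ∘ there))
          (sum-map-mono-< grows (Any.map accepted (cover (here refl))))
        where
        grows : ∀ y → length (filter (R? y) xs) ≤ length (filter (R? y) (x ∷ xs))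
        grows y with R? y x
        ... | yes _ = n≤1+n _
        ... | no  _ = ≤-refl

        accepted : ∀ {y} → R y x → length (filter (R? y) xs) < length (filter (R? y) (x ∷ xs))
        accepted {y} Ryx rewrite filter-accept (R? y) {xs = xs} Ryx = ≤-refl

    module _ {n k : ℕ} (f : A → Fin n) where

      length≤n*fibre : ∀ xs → (∀ i → length (filter (λ x → f x Fin.≟ i) xs) ≤ k) → length xs ≤ n * k
      length≤n*fibre xs fibre≤k = begin
        length xs
          ≤⟨ length≤sum-filters (λ i x → f x Fin.≟ i) (allFin n) xs (λ {x} _ → ∈-allFin (f x)) ⟩
        sum (map (λ i → length (filter (λ x → f x Fin.≟ i) xs)) (allFin n))
          ≤⟨ sum-map-≤ fibre≤k (allFin n) ⟩
        length (allFin n) * k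
          ≡⟨ cong (_* k) (length-tabulate {n = n} id) ⟩
        n * k                                                          ∎
        where open ≤-Reasoning

    module _ {n : ℕ} (f : A → Fin n) {xs : List A} (xs! : Unique xs) where

      private
        ∈-fibre : ∀ {i x} → x ∈ˡ filter (λ x → f x Fin.≟ i) xs → x ∈ˡ xs × f x ≡ i
        ∈-fibre {i} = ∈-filter⁻ (λ x → f x Fin.≟ i)

      length≤-injective : (∀ {x y} → x ∈ˡ xs → y ∈ˡ xs → f x ≡ f y → x ≡ y) → length xs ≤ n
      length≤-injective inj = subst (length xs ≤_) (*-identityʳ n)
        (length≤n*fibre f xs λ i → unique-length≤1 (Unique.filter⁺ (λ x → f x Fin.≟ i) xs!) λ x∈ y∈ →
          let x∈xs , fx≡i = ∈-fibre x∈; y∈xs , fy≡i = ∈-fibre y∈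
          in inj x∈xs y∈xs (trans fx≡i (sym fy≡i)))

      length≤-two-to-one :
        (∀ {x y z} → x ∈ˡ xs → y ∈ˡ xs → z ∈ˡ xs → f x ≡ f y → f x ≡ f z → x ≡ y ⊎ x ≡ z ⊎ y ≡ z) →
        length xs ≤ n * 2
      length≤-two-to-one coincide =
        length≤n*fibre f xs λ i → unique-length≤2 (Unique.filter⁺ (λ x → f x Fin.≟ i) xs!) λ x∈ y∈ z∈ →
          let x∈xs , fx≡i = ∈-fibre x∈; y∈xs , fy≡i = ∈-fibre y∈; z∈xs , fz≡i = ∈-fibre z∈
          in coincide x∈xs y∈xs z∈xs (trans fx≡i (sym fy≡i)) (trans fx≡i (sym fz≡i))

    length≤1+length-filter-≢ : (_≟_ : DecidableEquality A) (x : A) {xs : List A} → Unique xs →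
      length xs ≤ suc (length (filter (λ y → ¬? (x ≟ y)) xs))
    length≤1+length-filter-≢ _≟_ x []             = z≤n
    length≤1+length-filter-≢ _≟_ x {y ∷ ys} (y∉ys ∷ ys!) with x ≟ y
    -- Without duplicates `x` does not recur in `ys`, so the filter removes nothing more.
    ... | yes refl = s≤s (≤-reflexive (cong length (sym (filter-all (λ z → ¬? (x ≟ z)) y∉ys))))
    ... | no  _    = s≤s (length≤1+length-filter-≢ _≟_ x ys!)

  module _ {a b} {A : Set a} {B : Set b} where

    length-cartesianProduct : ∀ (xs : List A) (ys : List B) →
      length (cartesianProduct xs ys) ≡ length xs * length ys
    length-cartesianProduct []       ys = refl
    length-cartesianProduct (x ∷ xs) ys = trans (length-++ (map (x ,_) ys))
      (cong₂ _+_ (length-map (x ,_) ys) (length-cartesianProduct xs ys))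

    -- `index` recovers from an entry the block it came from, so blocks with different indices are
    -- disjoint.
    concatMap-unique : (f : A → List B) (index : B → A) →
      (∀ {x y} → y ∈ˡ f x → index y ≡ x) → (∀ x → Unique (f x)) →
      ∀ {xs} → Unique xs → Unique (concatMap f xs)
    concatMap-unique f index index-f f! []             = []
    concatMap-unique f index index-f f! {x ∷ xs} (x∉xs ∷ xs!) =
      Unique.++⁺ (f! x) (concatMap-unique f index index-f f! xs!) λ (y∈fx , y∈rest) →
        All¬⇒¬Any x∉xs (Any.map (λ y∈fz → trans (sym (index-f y∈fx)) (index-f y∈fz))
          (∈-concatMap⁻ f {xs = xs} y∈rest))

    -- The average c / k per block stays cross-multiplied, which avoids dividing natural numbers.
    concatMap-length : ∀ {c k} (f : A → List B) (xs : List A) →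
      (∀ {x} → x ∈ˡ xs → c ≤ k * length (f x)) → c * length xs ≤ k * length (concatMap f xs)
    concatMap-length {c} {k} f []       _   = ≤-reflexive (trans (*-zeroʳ c) (sym (*-zeroʳ k)))
    concatMap-length {c} {k} f (x ∷ xs) c≤k = begin
      c * suc (length xs)                                ≡⟨ *-suc c (length xs) ⟩
      c + c * length xs
        ≤⟨ +-mono-≤ (c≤k (here refl)) (concatMap-length {k = k} f xs (c≤k ∘ there)) ⟩
      k * length (f x) + k * length (concatMap f xs)     ≡⟨ *-distribˡ-+ k (length (f x)) _ ⟨
      k * (length (f x) + length (concatMap f xs))       ≡⟨ cong (k *_) (length-++ (f x)) ⟨
      k * length (concatMap f (x ∷ xs))                  ∎
      where open ≤-Reasoning

  module _ {b} {B : Set b} (size : B → ℕ) where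

    Heavy : ℕ → ℕ → Pred B _
    Heavy N l y = N ≤ 8 * l * size y

    heavy? : ∀ N l → Decidable (Heavy N l)
    heavy? N l y = N ≤? 8 * l * size y

  -- If N points are spread over the cells ys, the cells carrying less than an eighth of the average
  -- contain at most N / 8 points altogether.
  module _ {b} {B : Set b} (size : B → ℕ) {k : ℕ} (size≤k : ∀ y → size y ≤ k) where

    open ≤-Reasoning

    -- A light cell is charged `N`, any other cell 8 l k. The threshold parameter `l` is independent
    -- of `length ys`, so that it stays fixed while the induction shortens the list.
    sum-sizes : ∀ {p} {P : Pred B p} (P? : Decidable P) {N} l → (∀ {y} → ¬ P y → 8 * l * size y ≤ N) →
      ∀ ys → 8 * l * sum (map size ys) ≤ length ys * N + l * (8 * (k * length (filter P? ys)))
    sum-sizes P? {N} l light []       = ≤-trans (≤-reflexive (*-zeroʳ (8 * l))) z≤n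
    sum-sizes P? {N} l light (y ∷ ys) with P? y
    ... | no ¬Py = begin
      8 * l * (size y + sum (map size ys))                  ≡⟨ *-distribˡ-+ (8 * l) (size y) _ ⟩
      8 * l * size y + 8 * l * sum (map size ys)
        ≤⟨ +-mono-≤ (light ¬Py) (sum-sizes P? l light ys) ⟩
      N + (length ys * N + l * (8 * (k * _)))               ≡⟨ +-assoc N _ _ ⟨
      N + length ys * N + l * (8 * (k * _))                 ∎
    ... | yes _ = begin
      8 * l * (size y + sum (map size ys))                  ≡⟨ *-distribˡ-+ (8 * l) (size y) _ ⟩
      8 * l * size y + 8 * l * sum (map size ys)
        ≤⟨ +-mono-≤ (*-monoʳ-≤ (8 * l) (size≤k y)) (sum-sizes P? l light ys) ⟩
      -- A heavy cell is also counted in the term for the light ones, which leaves a spare `N`.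
      8 * l * k + (length ys * N + l * (8 * (k * h)))       ≤⟨ m≤n+m _ N ⟩
      N + (8 * l * k + (length ys * N + l * (8 * (k * h)))) ≡⟨ rearrange N l k (length ys) h ⟩
      N + length ys * N + l * (8 * (k * suc h))             ∎
      where
      h = length (filter P? ys)
      rearrange : ∀ N l k n h → N + (8 * l * k + (n * N + l * (8 * (k * h)))) ≡
                                N + n * N + l * (8 * (k * (1 + h)))
      rearrange = solve-∀

    many-heavy : ∀ {N} ys → .{{NonZero (length ys)}} → N ≤ sum (map size ys) →
      7 * N ≤ 8 * k * length (filter (heavy? size N (length ys)) ys)
    -- Of the 8 N on the left the light cells account for at most one, and the other 7 N remain for
    -- the heavy cells.
    many-heavy {N} ys N≤sum = +-cancelˡ-≤ N _ _ (*-cancelˡ-≤ l (begin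
      l * (8 * N)                   ≡⟨ x[8y]≡8xy l N ⟩
      8 * l * N                     ≤⟨ *-monoʳ-≤ (8 * l) N≤sum ⟩
      8 * l * sum (map size ys)     ≤⟨ sum-sizes (heavy? size N l) l (<⇒≤ ∘ ≰⇒>) ys ⟩
      l * N + l * (8 * (k * h))     ≡⟨ rearrange l N k h ⟩
      l * (N + 8 * k * h)           ∎))
      where
      l = length ys
      h = length (filter (heavy? size N l) ys)
      rearrange : ∀ l N k h → l * N + l * (8 * (k * h)) ≡ l * (N + 8 * k * h)
      rearrange = solve-∀
      x[8y]≡8xy : ∀ x y → x * (8 * y) ≡ 8 * x * y
      x[8y]≡8xy = solve-∀

open Counting

-- Finite fields of odd order, their vectors, and projections along a line

module _ where
  open ≡ using (refl; sym)

  -- Parity is all that the geometry takes from the prime power: it makes 2 nonzero in the field.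
  OddPrimePower⇒odd : ∀ {q} → OddPrimePower q → ∃[ j ] q ≡ 1 ℕ.+ j ℕ.* 2
  OddPrimePower⇒odd {q} (p , k , p-prime , p≢2 , _ , refl)
    with q % 2 in eq | m%n<n q 2 | m≡m%n+[m/n]*n q 2
  ... | 1 | _ | q≡1+[q/2]*2 = q / 2 , q≡1+[q/2]*2
  ... | 0 | _ | _ = contradiction (2∣p^⇒2∣p k (m%n≡0⇒n∣m q 2 eq)) 2∤p
    where
    2∣p^⇒2∣p : ∀ k → 2 ∣ p ℕ.^ k → 2 ∣ p
    2∣p^⇒2∣p zero    2∣1 with () ← ∣1⇒≡1 2∣1
    2∣p^⇒2∣p (suc k) 2∣p*p^k = [ id , 2∣p^⇒2∣p k ]′ (euclidsLemma p (p ℕ.^ k) prime[2] 2∣p*p^k)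
    2∤p : ¬ 2 ∣ p
    2∤p 2∣p with prime⇒irreducible p-prime 2∣p
    ... | inj₂ 2≡p = p≢2 (sym 2≡p)
  ... | suc (suc _) | s≤s (s≤s ()) | _

module FieldProperties {q : ℕ} (𝔽 : FiniteField q) where
  open ≡ using (refl; sym; trans; cong; cong₂; module ≡-Reasoning)
  open FiniteField 𝔽 using (Carrier; 2#; _⁻¹; _-_; _≟_; 0≢1; ⁻¹-inverseʳ; enumeration; isCommutativeRing)
  open Inverse enumeration using (to; from; strictlyInverseˡ; strictlyInverseʳ)

  ring : CommutativeRing _ _
  ring = record { isCommutativeRing = isCommutativeRing }

  open FiniteField 𝔽 using (_+_; _*_; -_; 0#; 1#)
  open IntegerCoefficientSolver ring
  open CommutativeRing ring using
    (+-group; +-comm; +-identityˡ; +-identityʳ; *-comm; *-assoc; *-identityˡ; zeroˡ; zeroʳ; -‿inverseʳ;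
     +-commutativeMonoid; semiring)
  open GroupProperties +-group using (//-rightDividesˡ; //-rightDividesʳ)
  open ≡-Reasoning

  2≤q : 2 ℕ.≤ q
  2≤q = at-least-two q to-injective
    where
    to-injective : to 0# ≢ to 1#
    to-injective eq = 0≢1 (begin
      0#           ≡⟨ strictlyInverseʳ 0# ⟨
      from (to 0#) ≡⟨ cong from eq ⟩
      from (to 1#) ≡⟨ strictlyInverseʳ 1# ⟩
      1#           ∎)
    at-least-two : ∀ n {i j : Fin n} → i ≢ j → 2 ℕ.≤ n
    at-least-two 1 {zero} {zero} i≢j = contradiction refl i≢j
    at-least-two (suc (suc _)) _     = s≤s (s≤s z≤n)

  *-cancelˡ : ∀ {a x y} → a ≢ 0# → a * x ≡ a * y → x ≡ y
  *-cancelˡ {a} {x} {y} a≢0 ax≡ay = begin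
    x              ≡⟨ *-identityˡ x ⟨
    1# * x         ≡⟨ cong (_* x) inv ⟨
    a ⁻¹ * a * x   ≡⟨ *-assoc (a ⁻¹) a x ⟩
    a ⁻¹ * (a * x) ≡⟨ cong (a ⁻¹ *_) ax≡ay ⟩
    a ⁻¹ * (a * y) ≡⟨ *-assoc (a ⁻¹) a y ⟨
    a ⁻¹ * a * y   ≡⟨ cong (_* y) inv ⟩
    1# * y         ≡⟨ *-identityˡ y ⟩
    y              ∎
    where
    inv : a ⁻¹ * a ≡ 1#
    inv = trans (*-comm (a ⁻¹) a) (⁻¹-inverseʳ a a≢0)

  x*y≡0⇒x≡0 : ∀ {x y} → x * y ≡ 0# → y ≢ 0# → x ≡ 0#
  x*y≡0⇒x≡0 {x} {y} xy≡0 y≢0 = *-cancelˡ y≢0 (trans (*-comm y x) (trans xy≡0 (sym (zeroʳ y))))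

  x≡x+y⇒y≡0 : ∀ {x y} → x ≡ x + y → y ≡ 0#
  x≡x+y⇒y≡0 {x} {y} x≡x+y = begin
    y         ≡⟨ solve 2 (λ x y → y := (x :+ y) :- x) refl x y ⟩
    x + y - x ≡⟨ cong (_- x) x≡x+y ⟨
    x - x     ≡⟨ -‿inverseʳ x ⟩
    0#        ∎

  [x-y]+y≡x : ∀ x y → x - y + y ≡ x
  [x-y]+y≡x x y = //-rightDividesˡ y x

  +-cancelʳ : ∀ z {x y} → x + z ≡ y + z → x ≡ y
  +-cancelʳ z {x} {y} eq =
    trans (sym (//-rightDividesʳ z x)) (trans (cong (_- z) eq) (//-rightDividesʳ z y))

  -- Summing x ↦ x + 1 and x ↦ x over the field shows that q · 1 = 0.
  odd⇒2≢0 : ∀ j → q ≡ 1 ℕ.+ j ℕ.* 2 → 2# ≢ 0#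
  odd⇒2≢0 j q≡1+2j 2≡0 = 0≢1 (begin
    0#                       ≡⟨ q×1≡0 ⟨
    q · 1#                   ≡⟨ cong (_· 1#) q≡1+2j ⟩
    1# + (j ℕ.* 2) · 1#      ≡⟨ cong (1# +_) (×-assocˡ 1# j 2) ⟨
    1# + j · (1# + (1# + 0#)) ≡⟨ cong (λ x → 1# + j · (1# + x)) (+-identityʳ 1#) ⟩
    1# + j · 2#              ≡⟨ cong (λ x → 1# + j · x) 2≡0 ⟩
    1# + j · 0#              ≡⟨ cong (1# +_) (trans (sym (sum-replicate j)) (sum-replicate-zero j)) ⟩
    1# + 0#                  ≡⟨ +-identityʳ 1# ⟩
    1#                       ∎)
    where
    open CommutativeMonoidSum +-commutativeMonoid
    open SemiringMult semiring using (×-assocˡ) renaming (_×_ to _·_)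

    shift = permutation (λ i → to (from i + 1#)) (λ i → to (from i - 1#))
      (λ i → trans (cong (λ x → to (x + 1#)) (strictlyInverseʳ (from i - 1#)))
                   (trans (cong to ([x-y]+y≡x (from i) 1#)) (strictlyInverseˡ i)))
      (λ i → trans (cong (λ x → to (x - 1#)) (strictlyInverseʳ (from i + 1#)))
                   (trans (cong to (//-rightDividesʳ 1# (from i))) (strictlyInverseˡ i)))

    q×1≡0 : q · 1# ≡ 0#
    q×1≡0 = +-cancelʳ (sum from) (begin
      q · 1# + sum from                     ≡⟨ +-comm (q · 1#) (sum from) ⟩
      sum from + q · 1#                     ≡⟨ cong (sum from +_) (sum-replicate q) ⟨
      sum from + sum {q} (λ _ → 1#)         ≡⟨ ∑-distrib-+ {q} from (λ _ → 1#) ⟨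
      sum (λ i → from i + 1#)               ≡⟨ sum-cong-≗ (λ i → sym (strictlyInverseʳ (from i + 1#))) ⟩
      sum (λ i → from (to (from i + 1#)))   ≡⟨ sum-permute from shift ⟨
      sum from                              ≡⟨ +-identityˡ (sum from) ⟨
      0# + sum from                         ∎)

  -- The dimension is implicit because the projections below lower it.
  open module Vectors {n} = Geometry 𝔽 n using (_+ᵥ_; _-ᵥ_; _*ᵥ_; 0ᵥ) public

  +ᵥ-comm : ∀ {n} (x y : Vec Carrier n) → x +ᵥ y ≡ y +ᵥ x
  +ᵥ-comm = Vec.zipWith-comm +-comm

  [x-y]+y≡xᵥ : ∀ {n} (x y : Vec Carrier n) → (x -ᵥ y) +ᵥ y ≡ x
  [x-y]+y≡xᵥ []       []       = refl
  [x-y]+y≡xᵥ (x ∷ xs) (y ∷ ys) = cong₂ _∷_ ([x-y]+y≡x x y) ([x-y]+y≡xᵥ xs ys)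

  x-y≡x+[-1]y : ∀ {n} (x y : Vec Carrier n) → x -ᵥ y ≡ x +ᵥ (- 1#) *ᵥ y
  x-y≡x+[-1]y []       []       = refl
  x-y≡x+[-1]y (x ∷ xs) (y ∷ ys) =
    cong₂ _∷_ (solve 2 (λ x y → x :- y := x :+ (:- con 1ℤ) :* y) refl x y) (x-y≡x+[-1]y xs ys)

  x+0y≡x : ∀ {n} (x y : Vec Carrier n) → x +ᵥ 0# *ᵥ y ≡ x
  x+0y≡x []       []       = refl
  x+0y≡x (x ∷ xs) (y ∷ ys) = cong₂ _∷_ (trans (cong (x +_) (zeroˡ y)) (+-identityʳ x)) (x+0y≡x xs ys)

  0+x≡xᵥ : ∀ {n} (x : Vec Carrier n) → 0ᵥ +ᵥ x ≡ x
  0+x≡xᵥ = Vec.zipWith-identityˡ +-identityˡ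

  0*x≡0ᵥ : ∀ {n} (x : Vec Carrier n) → 0# *ᵥ x ≡ 0ᵥ
  0*x≡0ᵥ x = trans (Vec.map-cong zeroˡ x) (Vec.map-const x 0#)

  0+1x≡xᵥ : ∀ {n} (x : Vec Carrier n) → 0ᵥ +ᵥ 1# *ᵥ x ≡ x
  0+1x≡xᵥ x = trans (0+x≡xᵥ (1# *ᵥ x)) (trans (Vec.map-cong *-identityˡ x) (Vec.map-id x))

  x+a0≡xᵥ : ∀ {n} a (x : Vec Carrier n) → x +ᵥ a *ᵥ 0ᵥ ≡ x
  x+a0≡xᵥ a []       = refl
  x+a0≡xᵥ a (x ∷ xs) = cong₂ _∷_ (solve 2 (λ a x → x :+ a :* con ℤ.0ℤ := x) refl a x) (x+a0≡xᵥ a xs)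

  [x-ay]+ay≡x : ∀ {n} a (x y : Vec Carrier n) → (x +ᵥ (- a) *ᵥ y) +ᵥ a *ᵥ y ≡ x
  [x-ay]+ay≡x a []       []       = refl
  [x-ay]+ay≡x a (x ∷ xs) (y ∷ ys) =
    cong₂ _∷_ (solve 3 (λ a x y → x :+ (:- a) :* y :+ a :* y := x) refl a x y) ([x-ay]+ay≡x a xs ys)

  x≢y⇒y-x≢0ᵥ : ∀ {n} {x y : Vec Carrier n} → x ≢ y → y -ᵥ x ≢ 0ᵥ
  x≢y⇒y-x≢0ᵥ {x = x} {y} x≢y y-x≡0 = x≢y (begin
    x               ≡⟨ 0+x≡xᵥ x ⟨
    0ᵥ +ᵥ x         ≡⟨ cong (_+ᵥ x) y-x≡0 ⟨
    (y -ᵥ x) +ᵥ x   ≡⟨ [x-y]+y≡xᵥ y x ⟩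
    y               ∎)

  [x+ay]-z≡[x-z]+ay : ∀ {n} a (x y z : Vec Carrier n) → (x +ᵥ a *ᵥ y) -ᵥ z ≡ (x -ᵥ z) +ᵥ a *ᵥ y
  [x+ay]-z≡[x-z]+ay a []       []       []       = refl
  [x+ay]-z≡[x-z]+ay a (x ∷ xs) (y ∷ ys) (z ∷ zs) =
    cong₂ _∷_ (solve 4 (λ a x y z → (x :+ a :* y) :- z := (x :- z) :+ a :* y) refl a x y z)
              ([x+ay]-z≡[x-z]+ay a xs ys zs)

  abstract
    -- Coordinates serve as base-q digits. Only the bijection is used later, so the encoding is
    -- opaque.
    vectors : ∀ n → Vec Carrier n ↔ Fin (q ℕ.^ n)
    vectors n = mk↔ₛ′ encode (decode n) (encode-decode n) decode-encode
      where
      encode : ∀ {n} → Vec Carrier n → Fin (q ℕ.^ n)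
      encode []       = zero
      encode (x ∷ xs) = combine (to x) (encode xs)

      decode : ∀ n → Fin (q ℕ.^ n) → Vec Carrier n
      decode zero    _ = []
      decode (suc n) i = from (proj₁ (remQuot {q} (q ℕ.^ n) i)) ∷ decode n (proj₂ (remQuot {q} (q ℕ.^ n) i))

      encode-decode : ∀ n i → encode (decode n i) ≡ i
      encode-decode zero    zero = refl
      encode-decode (suc n) i    = trans
        (cong₂ combine (strictlyInverseˡ _) (encode-decode n _)) (Fin.combine-remQuot {q} (q ℕ.^ n) i)

      decode-encode : ∀ {n} (x : Vec Carrier n) → decode n (encode x) ≡ x
      decode-encode []       = refl
      decode-encode {suc n} (x ∷ xs) = trans
        (cong (λ (i , j) → from i ∷ decode n j) (Fin.remQuot-combine {q} (to x) (encode xs)))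
        (cong₂ _∷_ (strictlyInverseʳ x) (decode-encode xs))

  encode : ∀ {n} → Vec Carrier n → Fin (q ℕ.^ n)
  encode = Inverse.to (vectors _)

  encode-injective : ∀ {n} {x y : Vec Carrier n} → encode x ≡ encode y → x ≡ y
  encode-injective = Injection.injective (↔⇒↣ (vectors _))

  decode-injective : ∀ {n} {i j : Fin (q ℕ.^ n)} →
    Inverse.from (vectors n) i ≡ Inverse.from (vectors n) j → i ≡ j
  decode-injective = Injection.injective (↔⇒↣ (↔-sym (vectors _)))

  -- The quotient map by the line spanned by `w`, with values in one coordinate fewer. `π-affine`
  -- expresses linearity in the form in which points of a line occur.
  record Projection {n} (w : Vec Carrier (suc n)) : Set where
    field
      π        : Vec Carrier (suc n) → Vec Carrier n
      π-affine : ∀ a x v → π (x +ᵥ a *ᵥ v) ≡ π x +ᵥ a *ᵥ π v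
      π-fibre  : ∀ {x y} → π x ≡ π y → ∃[ a ] y ≡ x +ᵥ a *ᵥ w

  -- Elimination with the first nonzero coordinate of `w` as pivot: subtract the multiple of `w`
  -- that kills the pivot coordinate, then drop that coordinate. The coordinates before the pivot
  -- are kept.
  project : ∀ {n} (w : Vec Carrier (suc n)) → w ≢ 0ᵥ → Projection w
  project (b ∷ ws) w≢0 with b ≟ 0#
  project {n} (b ∷ ws) w≢0 | no b≢0 = record { π = π ; π-affine = π-affine ; π-fibre = π-fibre }
    where
    c = b ⁻¹

    π : Vec Carrier (suc n) → Vec Carrier n
    π (x ∷ xs) = xs +ᵥ (- (x * c)) *ᵥ ws

    π-affine : ∀ a x v → π (x +ᵥ a *ᵥ v) ≡ π x +ᵥ a *ᵥ π v
    π-affine a (x ∷ xs) (v ∷ vs) = go xs vs ws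
      where
      go : ∀ {m} (xs vs ws : Vec Carrier m) →
        (xs +ᵥ a *ᵥ vs) +ᵥ (- ((x + a * v) * c)) *ᵥ ws ≡
        (xs +ᵥ (- (x * c)) *ᵥ ws) +ᵥ a *ᵥ (vs +ᵥ (- (v * c)) *ᵥ ws)
      go []       []       []       = refl
      go (y ∷ xs) (u ∷ vs) (w ∷ ws) = cong₂ _∷_
        (solve 7 (λ a c x v y u w →
          y :+ a :* u :+ (:- ((x :+ a :* v) :* c)) :* w :=
          y :+ (:- (x :* c)) :* w :+ a :* (u :+ (:- (v :* c)) :* w)) refl a c x v y u w)
        (go xs vs ws)

    π-fibre : ∀ {x y} → π x ≡ π y → ∃[ a ] y ≡ x +ᵥ a *ᵥ (b ∷ ws)
    -- The parameter solves the pivot equation y = x + a b.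
    π-fibre {x ∷ xs} {y ∷ ys} eq = (y - x) * c , cong₂ _∷_ head (go xs ys ws eq)
      where
      head : y ≡ x + (y - x) * c * b
      head = begin
        y                     ≡⟨ solve 2 (λ x y → y := x :+ (y :- x) :* con 1ℤ) refl x y ⟩
        x + (y - x) * 1#      ≡⟨ cong (λ z → x + (y - x) * z) (⁻¹-inverseʳ b b≢0) ⟨
        x + (y - x) * (b * c)
          ≡⟨ solve 4 (λ x y b c → x :+ (y :- x) :* (b :* c) := x :+ (y :- x) :* c :* b) refl x y b c ⟩
        x + (y - x) * c * b   ∎
      go : ∀ {m} (xs ys ws : Vec Carrier m) →
        xs +ᵥ (- (x * c)) *ᵥ ws ≡ ys +ᵥ (- (y * c)) *ᵥ ws → ys ≡ xs +ᵥ ((y - x) * c) *ᵥ ws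
      go []       []       []       _  = refl
      go (u ∷ xs) (v ∷ ys) (w ∷ ws) eq = cong₂ _∷_
        (begin
          v
            ≡⟨ solve 4 (λ c y v w → v := v :+ (:- (y :* c)) :* w :+ y :* c :* w) refl c y v w ⟩
          v + - (y * c) * w + y * c * w     ≡⟨ cong (_+ y * c * w) (Vec.∷-injectiveˡ eq) ⟨
          u + - (x * c) * w + y * c * w
            ≡⟨ solve 5 (λ c x y u w → u :+ (:- (x :* c)) :* w :+ y :* c :* w := u :+ (y :- x) :* c :* w)
                 refl c x y u w ⟩
          u + (y - x) * c * w               ∎)
        (go xs ys ws (Vec.∷-injectiveʳ eq))
  project {zero}  (b ∷ []) w≢0 | yes refl = contradiction refl w≢0
  project {suc n} (b ∷ ws) w≢0 | yes refl = record { π = π ; π-affine = π-affine ; π-fibre = π-fibre }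
    where
    module ρ = Projection (project ws (w≢0 ∘ cong (0# ∷_)))

    π : Vec Carrier (suc (suc n)) → Vec Carrier (suc n)
    π (x ∷ xs) = x ∷ ρ.π xs

    π-affine : ∀ a x v → π (x +ᵥ a *ᵥ v) ≡ π x +ᵥ a *ᵥ π v
    π-affine a (x ∷ xs) (v ∷ vs) = cong (x + a * v ∷_) (ρ.π-affine a xs vs)

    π-fibre : ∀ {x y} → π x ≡ π y → ∃[ a ] y ≡ x +ᵥ a *ᵥ (0# ∷ ws)
    π-fibre {x ∷ xs} {y ∷ ys} eq =
      let a , ys≡xs+aws = ρ.π-fibre (Vec.∷-injectiveʳ eq)
      in a , cong₂ _∷_
        (trans (sym (Vec.∷-injectiveˡ eq)) (sym (trans (cong (x +_) (zeroʳ a)) (+-identityʳ x)))) ys≡xs+aws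

-- Quadratic forms, radical hyperplanes and totally isotropic hyperplanes

module FormProperties {q : ℕ} (𝔽 : FiniteField q) (2≢0 : FiniteField.2# 𝔽 ≢ FiniteField.0# 𝔽)
  {d : ℕ}
  (Q : Vec (FiniteField.Carrier 𝔽) d → FiniteField.Carrier 𝔽)
  (isQuadraticForm : Geometry.IsQuadraticForm 𝔽 d Q) where

  open ≡ using (refl; sym; trans; cong; cong₂; module ≡-Reasoning)
  open FiniteField 𝔽 using (Carrier; _+_; _*_; -_; 0#; 1#; 2#; _⁻¹; _-_; _≟_; ⁻¹-inverseʳ)
  open FieldProperties 𝔽
  open CommutativeRing ring using (zeroˡ; *-identityʳ)
  open IntegerCoefficientSolver ring
  open Geometry 𝔽 d using (Point; Sphere; RadicalHyperplane; Nondegenerate; module IsQuadraticForm)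
    renaming (⟨_,_⟩ to polar)
  open IsQuadraticForm isQuadraticForm
  open ≡-Reasoning

  infix 9 ⟨_,_⟩
  ⟨_,_⟩ : Point → Point → Carrier
  ⟨_,_⟩ = polar Q

  2⟨,⟩ : ∀ x y → 2# * ⟨ x , y ⟩ ≡ Q (x +ᵥ y) - Q x - Q y
  2⟨,⟩ x y = begin
    2# * (z * 2# ⁻¹) ≡⟨ solve 3 (λ t z i → t :* (z :* i) := z :* (t :* i)) refl 2# z (2# ⁻¹) ⟩
    z * (2# * 2# ⁻¹) ≡⟨ cong (z *_) (⁻¹-inverseʳ 2# 2≢0) ⟩
    z * 1#           ≡⟨ *-identityʳ z ⟩
    z                ∎
    where z = Q (x +ᵥ y) - Q x - Q y

  ⟨,⟩-comm : ∀ x y → ⟨ x , y ⟩ ≡ ⟨ y , x ⟩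
  ⟨,⟩-comm x y = cong (_* 2# ⁻¹) (begin
    Q (x +ᵥ y) - Q x - Q y ≡⟨ cong (λ z → Q z - Q x - Q y) (+ᵥ-comm x y) ⟩
    Q (y +ᵥ x) - Q x - Q y
      ≡⟨ solve 3 (λ a b c → a :- b :- c := a :- c :- b) refl (Q (y +ᵥ x)) (Q x) (Q y) ⟩
    Q (y +ᵥ x) - Q y - Q x ∎)

  ⟨,⟩-affineˡ : ∀ a x v y → ⟨ x +ᵥ a *ᵥ v , y ⟩ ≡ ⟨ x , y ⟩ + a * ⟨ v , y ⟩
  ⟨,⟩-affineˡ a x v y = trans (additive x (a *ᵥ v) y) (cong (⟨ x , y ⟩ +_) (scaling a v y))

  ⟨,⟩-affineʳ : ∀ a x v y → ⟨ y , x +ᵥ a *ᵥ v ⟩ ≡ ⟨ y , x ⟩ + a * ⟨ y , v ⟩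
  ⟨,⟩-affineʳ a x v y = trans (⟨,⟩-comm y (x +ᵥ a *ᵥ v))
    (trans (⟨,⟩-affineˡ a x v y) (cong₂ (λ s t → s + a * t) (⟨,⟩-comm x y) (⟨,⟩-comm v y)))

  ⟨x,0⟩≡0 : ∀ x → ⟨ x , 0ᵥ ⟩ ≡ 0#
  ⟨x,0⟩≡0 x = begin
    ⟨ x , 0ᵥ ⟩         ≡⟨ ⟨,⟩-comm x 0ᵥ ⟩
    ⟨ 0ᵥ , x ⟩         ≡⟨ cong ⟨_, x ⟩ (0*x≡0ᵥ 0ᵥ) ⟨
    ⟨ 0# *ᵥ 0ᵥ , x ⟩   ≡⟨ scaling 0# 0ᵥ x ⟩
    0# * ⟨ 0ᵥ , x ⟩    ≡⟨ zeroˡ _ ⟩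
    0#                 ∎

  Q0≡0 : Q 0ᵥ ≡ 0#
  Q0≡0 = begin
    Q 0ᵥ              ≡⟨ cong Q (0*x≡0ᵥ 0ᵥ) ⟨
    Q (0# *ᵥ 0ᵥ)      ≡⟨ homogeneous 0# 0ᵥ ⟩
    0# * 0# * Q 0ᵥ    ≡⟨ solve 1 (λ x → con ℤ.0ℤ :* con ℤ.0ℤ :* x := con ℤ.0ℤ) refl (Q 0ᵥ) ⟩
    0#                ∎

  -- The factor `a` is kept in front so that, on a line through a point of a sphere, every other
  -- point of the sphere is a root of the remaining linear factor.
  Q-affine : ∀ a x v → Q (x +ᵥ a *ᵥ v) ≡ Q x + a * (a * Q v + 2# * ⟨ x , v ⟩)
  Q-affine a x v = begin
    Q (x +ᵥ a *ᵥ v)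
      ≡⟨ solve 3 (λ s t u → s := s :- t :- u :+ (t :+ u)) refl (Q (x +ᵥ a *ᵥ v)) (Q x) (Q (a *ᵥ v)) ⟩
    Q (x +ᵥ a *ᵥ v) - Q x - Q (a *ᵥ v) + (Q x + Q (a *ᵥ v))
      ≡⟨ cong₂ (λ s t → s + (Q x + t)) (sym (2⟨,⟩ x (a *ᵥ v))) (homogeneous a v) ⟩
    2# * ⟨ x , a *ᵥ v ⟩ + (Q x + a * a * Q v)
      ≡⟨ cong (λ s → 2# * s + (Q x + a * a * Q v))
           (trans (⟨,⟩-comm x (a *ᵥ v)) (trans (scaling a v x) (cong (a *_) (⟨,⟩-comm v x)))) ⟩
    2# * (a * ⟨ x , v ⟩) + (Q x + a * a * Q v)
      ≡⟨ solve 5 (λ t a b s u → t :* (a :* b) :+ (s :+ a :* a :* u) := s :+ a :* (a :* u :+ t :* b)) refl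
           2# a ⟨ x , v ⟩ (Q x) (Q v) ⟩
    Q x + a * (a * Q v + 2# * ⟨ x , v ⟩) ∎

  Q-difference : ∀ x c → Q (x -ᵥ c) ≡ Q x + Q c - 2# * ⟨ c , x ⟩
  Q-difference x c = begin
    Q (x -ᵥ c)                                    ≡⟨ cong Q (x-y≡x+[-1]y x c) ⟩
    Q (x +ᵥ (- 1#) *ᵥ c)                          ≡⟨ Q-affine (- 1#) x c ⟩
    Q x + - 1# * (- 1# * Q c + 2# * ⟨ x , c ⟩)
      ≡⟨ solve 4 (λ s t u b → s :+ (:- con 1ℤ) :* ((:- con 1ℤ) :* t :+ u :* b) := s :+ t :- u :* b) refl
           (Q x) (Q c) 2# ⟨ x , c ⟩ ⟩
    Q x + Q c - 2# * ⟨ x , c ⟩                    ≡⟨ cong (λ s → Q x + Q c - 2# * s) (⟨,⟩-comm x c) ⟩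
    Q x + Q c - 2# * ⟨ c , x ⟩                    ∎

  -- Subtracting the two sphere equations cancels `Q x` and leaves a linear equation.
  spheres⇒radicalHyperplane : ∀ {c r c′ r′ x} →
    Sphere Q c r x → Sphere Q c′ r′ x → RadicalHyperplane Q c r c′ r′ x
  spheres⇒radicalHyperplane {c} {_} {c′} {_} {x} refl refl = begin
    2# * ⟨ c′ -ᵥ c , x ⟩
      ≡⟨ cong (λ s → 2# * ⟨ s , x ⟩) (x-y≡x+[-1]y c′ c) ⟩
    2# * ⟨ c′ +ᵥ (- 1#) *ᵥ c , x ⟩
      ≡⟨ cong (2# *_) (⟨,⟩-affineˡ (- 1#) c′ c x) ⟩
    2# * (⟨ c′ , x ⟩ + - 1# * ⟨ c , x ⟩)
      ≡⟨ solve 6 (λ t b′ b s u u′ → t :* (b′ :+ (:- con 1ℤ) :* b) :=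
           ((s :+ u :- t :* b) :- (s :+ u′ :- t :* b′)) :- u :+ u′) refl
           2# ⟨ c′ , x ⟩ ⟨ c , x ⟩ (Q x) (Q c) (Q c′) ⟩
    ((Q x + Q c - 2# * ⟨ c , x ⟩) - (Q x + Q c′ - 2# * ⟨ c′ , x ⟩)) - Q c + Q c′
      ≡⟨ cong₂ (λ s t → (s - t) - Q c + Q c′) (Q-difference x c) (Q-difference x c′) ⟨
    (Q (x -ᵥ c) - Q (x -ᵥ c′)) - Q c + Q c′ ∎

  -- Moving by `a` along `w` changes ⟨u, ·⟩ by a ⟨u, w⟩, so a line in direction `w` meets each level
  -- set of ⟨u, ·⟩ at most once.
  transversal : ∀ {u w x a} → ⟨ u , w ⟩ ≢ 0# → ⟨ u , x ⟩ ≡ ⟨ u , x +ᵥ a *ᵥ w ⟩ → x +ᵥ a *ᵥ w ≡ x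
  transversal {u} {w} {x} {a} ⟨u,w⟩≢0 eq =
    trans (cong (λ a → x +ᵥ a *ᵥ w) (x*y≡0⇒x≡0 (x≡x+y⇒y≡0 (trans eq (⟨,⟩-affineʳ a x w u))) ⟨u,w⟩≢0))
      (x+0y≡x x w)

  ⟨u,w⟩≢0⇒w≢0 : ∀ {u w} → ⟨ u , w ⟩ ≢ 0# → w ≢ 0ᵥ
  ⟨u,w⟩≢0⇒w≢0 ⟨u,w⟩≢0 refl = ⟨u,w⟩≢0 (⟨x,0⟩≡0 _)

  -- The doubly negated existence of `w` suffices: each use proves a decidable inequality, from
  -- which `decidable-stable` removes the negations.
  nondegenerate-pairing : Nondegenerate Q → ∀ {u} → u ≢ 0ᵥ → ¬ (∀ w → ¬ ⟨ u , w ⟩ ≢ 0#)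
  nondegenerate-pairing nondegenerate {u} u≢0 none =
    u≢0 (nondegenerate u λ w → decidable-stable (⟨ u , w ⟩ ≟ 0#) (none w))

  radicalHyperplane-level : ∀ {c r c′ r′ x y} → RadicalHyperplane Q c r c′ r′ x →
    RadicalHyperplane Q c r c′ r′ y → ⟨ c′ -ᵥ c , x ⟩ ≡ ⟨ c′ -ᵥ c , y ⟩
  radicalHyperplane-level Hx Hy = *-cancelˡ 2≢0 (trans Hx (sym Hy))

  -- If Q vanished on u^⊥, then u^⊥ would lie in the radical of Q restricted to u^⊥, that is, in the line
  -- spanned by u.
  isotropic-hyperplane : Nondegenerate Q → ∀ {u w} → ⟨ u , w ⟩ ≢ 0# →
    (∀ v → ⟨ u , v ⟩ ≡ 0# → Q v ≡ 0#) → q ℕ.^ d ℕ.≤ q ℕ.^ 2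
  isotropic-hyperplane nondegenerate {u} {w} ⟨u,w⟩≢0 isotropic =
    -- The coordinates with respect to `u` and `w` embed the whole space in the plane.
    Fin.injective⇒≤ {f = encode ∘ coordinates ∘ Inverse.from (vectors d)}
      (decode-injective ∘ coordinates-injective ∘ encode-injective)
    where
    e = ⟨ u , w ⟩ ⁻¹

    -- Every x splits as `foot x` in u^⊥ plus a multiple of `w`.
    height : Point → Carrier
    height x = ⟨ u , x ⟩ * e

    foot : Point → Point
    foot x = x +ᵥ (- height x) *ᵥ w

    s-se⟨u,w⟩≡0 : ∀ s → s + - (s * e) * ⟨ u , w ⟩ ≡ 0#
    s-se⟨u,w⟩≡0 s = begin
      s + - (s * e) * ⟨ u , w ⟩
        ≡⟨ solve 3 (λ s e b → s :+ (:- (s :* e)) :* b := s :- s :* (b :* e)) refl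
                                           s e ⟨ u , w ⟩ ⟩
      s - s * (⟨ u , w ⟩ * e)         ≡⟨ cong (λ t → s - s * t) (⁻¹-inverseʳ _ ⟨u,w⟩≢0) ⟩
      s - s * 1#                      ≡⟨ solve 1 (λ s → s :- s :* con 1ℤ := con ℤ.0ℤ) refl s ⟩
      0#                              ∎

    ⟨u,foot⟩≡0 : ∀ x → ⟨ u , foot x ⟩ ≡ 0#
    ⟨u,foot⟩≡0 x = trans (⟨,⟩-affineʳ (- height x) x w u) (s-se⟨u,w⟩≡0 ⟨ u , x ⟩)

    x≡foot+height*w : ∀ x → x ≡ foot x +ᵥ height x *ᵥ w
    x≡foot+height*w x = sym ([x-ay]+ay≡x (height x) x w)

    orthogonal : ∀ {v v′} → ⟨ u , v ⟩ ≡ 0# → ⟨ u , v′ ⟩ ≡ 0# → ⟨ v , v′ ⟩ ≡ 0#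
    -- Polarization: Q vanishes at v, v′ and their sum, all of which lie in u^⊥.
    orthogonal {v} {v′} v⊥u v′⊥u = *-cancelˡ 2≢0 (begin
      2# * ⟨ v , v′ ⟩                ≡⟨ 2⟨,⟩ v v′ ⟩
      Q (v +ᵥ v′) - Q v - Q v′
        ≡⟨ cong₂ _-_ (cong₂ _-_ (isotropic (v +ᵥ v′) v+v′⊥u) (isotropic v v⊥u)) (isotropic v′ v′⊥u) ⟩
      0# - 0# - 0#
        ≡⟨ solve 1 (λ t → con ℤ.0ℤ :- con ℤ.0ℤ :- con ℤ.0ℤ := t :* con ℤ.0ℤ) refl 2# ⟩
      2# * 0#                        ∎)
      where
      v+v′⊥u : ⟨ u , v +ᵥ v′ ⟩ ≡ 0#
      v+v′⊥u = begin
        ⟨ u , v +ᵥ v′ ⟩         ≡⟨ ⟨,⟩-comm u (v +ᵥ v′) ⟩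
        ⟨ v +ᵥ v′ , u ⟩         ≡⟨ additive v v′ u ⟩
        ⟨ v , u ⟩ + ⟨ v′ , u ⟩  ≡⟨ cong₂ _+_ (trans (⟨,⟩-comm v u) v⊥u) (trans (⟨,⟩-comm v′ u) v′⊥u) ⟩
        0# + 0#                 ≡⟨ solve 0 (con ℤ.0ℤ :+ con ℤ.0ℤ := con ℤ.0ℤ) refl ⟩
        0#                      ∎

    -- Chosen so that `foot x` minus `slope x` times `u` is orthogonal to `w`. This difference is
    -- also orthogonal to u^⊥, hence to everything, and vanishes by nondegeneracy.
    slope : Point → Carrier
    slope x = ⟨ foot x , w ⟩ * e

    foot≡slope*u : ∀ x → foot x ≡ 0ᵥ +ᵥ slope x *ᵥ u
    foot≡slope*u x = begin
      foot x                                                  ≡⟨ [x-ay]+ay≡x (slope x) (foot x) u ⟨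
      (foot x +ᵥ (- slope x) *ᵥ u) +ᵥ slope x *ᵥ u
        ≡⟨ cong (_+ᵥ slope x *ᵥ u) (nondegenerate z ⟨z,y⟩≡0) ⟩
      0ᵥ +ᵥ slope x *ᵥ u                                      ∎
      where
      z = foot x +ᵥ (- slope x) *ᵥ u
      ⟨z,w⟩≡0 : ⟨ z , w ⟩ ≡ 0#
      ⟨z,w⟩≡0 = trans (⟨,⟩-affineˡ (- slope x) (foot x) u w) (s-se⟨u,w⟩≡0 ⟨ foot x , w ⟩)

      ⟨z,foot⟩≡0 : ∀ y → ⟨ z , foot y ⟩ ≡ 0#
      ⟨z,foot⟩≡0 y = begin
        ⟨ z , foot y ⟩
          ≡⟨ ⟨,⟩-affineˡ (- slope x) (foot x) u (foot y) ⟩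
        ⟨ foot x , foot y ⟩ + - slope x * ⟨ u , foot y ⟩
          ≡⟨ cong₂ (λ s t → s + - slope x * t) (orthogonal (⟨u,foot⟩≡0 x) (⟨u,foot⟩≡0 y)) (⟨u,foot⟩≡0 y) ⟩
        0# + - slope x * 0#
          ≡⟨ solve 1 (λ s → con ℤ.0ℤ :+ s :* con ℤ.0ℤ := con ℤ.0ℤ) refl (- slope x) ⟩
        0#                                                  ∎
      ⟨z,y⟩≡0 : ∀ y → ⟨ z , y ⟩ ≡ 0#
      ⟨z,y⟩≡0 y = begin
        ⟨ z , y ⟩                                 ≡⟨ cong ⟨ z ,_⟩ (x≡foot+height*w y) ⟩
        ⟨ z , foot y +ᵥ height y *ᵥ w ⟩           ≡⟨ ⟨,⟩-affineʳ (height y) (foot y) w z ⟩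
        ⟨ z , foot y ⟩ + height y * ⟨ z , w ⟩
          ≡⟨ cong₂ (λ s t → s + height y * t) (⟨z,foot⟩≡0 y) ⟨z,w⟩≡0 ⟩
        0# + height y * 0#
          ≡⟨ solve 1 (λ s → con ℤ.0ℤ :+ s :* con ℤ.0ℤ := con ℤ.0ℤ) refl (height y) ⟩
        0#                                        ∎

    coordinates : Point → Vec Carrier 2
    coordinates x = slope x ∷ height x ∷ []

    combination : Vec Carrier 2 → Point
    combination (s ∷ t ∷ []) = (0ᵥ +ᵥ s *ᵥ u) +ᵥ t *ᵥ w

    combination-coordinates : ∀ x → combination (coordinates x) ≡ x
    combination-coordinates x =
      trans (cong (_+ᵥ height x *ᵥ w) (sym (foot≡slope*u x))) (sym (x≡foot+height*w x))

    coordinates-injective : ∀ {x y} → coordinates x ≡ coordinates y → x ≡ y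
    coordinates-injective {x} {y} eq = begin
      x                                  ≡⟨ combination-coordinates x ⟨
      combination (coordinates x)        ≡⟨ cong combination eq ⟩
      combination (coordinates y)        ≡⟨ combination-coordinates y ⟩
      y                                  ∎

-- Upper bounds for the size of a cell

module RadicalHyperplaneBound {q : ℕ} (𝔽 : FiniteField q) (2≢0 : FiniteField.2# 𝔽 ≢ FiniteField.0# 𝔽)
  {n : ℕ}
  (Q : Vec (FiniteField.Carrier 𝔽) (suc n) → FiniteField.Carrier 𝔽)
  (isQuadraticForm : Geometry.IsQuadraticForm 𝔽 (suc n) Q)
  (nondegenerate : Geometry.Nondegenerate 𝔽 (suc n) Q) where

  open ≡ using (sym; trans; cong)
  open FiniteField 𝔽 using (0#)
  open FieldProperties 𝔽
  open FormProperties 𝔽 2≢0 Q isQuadraticForm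
  open Geometry 𝔽 (suc n) using (Point; RadicalHyperplane)

  -- The hyperplane is a level set of ⟨c′ - c, ·⟩, so projecting along a direction that pairs
  -- nontrivially with c′ - c is injective on it.
  length-radicalHyperplane : ∀ {c r c′ r′} → c ≢ c′ → {xs : List Point} → Unique xs →
    (∀ {x} → x ∈ˡ xs → RadicalHyperplane Q c r c′ r′ x) → length xs ℕ.≤ q ℕ.^ n
  length-radicalHyperplane {c} {c′ = c′} c≢c′ {xs} xs! H =
    decidable-stable (length xs ℕ.≤? q ℕ.^ n) λ ≰ →
      nondegenerate-pairing nondegenerate (x≢y⇒y-x≢0ᵥ c≢c′) λ w ⟨u,w⟩≢0 → ≰ (bound ⟨u,w⟩≢0)
    where
    bound : ∀ {w} → ⟨ c′ -ᵥ c , w ⟩ ≢ 0# → length xs ℕ.≤ q ℕ.^ n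
    bound {w} ⟨u,w⟩≢0 = length≤-injective (encode ∘ π) xs! λ x∈ y∈ eq →
      let _ , y≡x+aw = π-fibre (encode-injective eq)
      in sym (trans y≡x+aw (transversal ⟨u,w⟩≢0
           (trans (radicalHyperplane-level (H x∈) (H y∈)) (cong ⟨ c′ -ᵥ c ,_⟩ y≡x+aw))))
      where
      open Projection (project w (⟨u,w⟩≢0⇒w≢0 {c′ -ᵥ c} ⟨u,w⟩≢0))

module SphereIntersectionBound {q : ℕ} (𝔽 : FiniteField q) (2≢0 : FiniteField.2# 𝔽 ≢ FiniteField.0# 𝔽)
  {n : ℕ}
  (Q : Vec (FiniteField.Carrier 𝔽) (suc (suc n)) → FiniteField.Carrier 𝔽)
  (isQuadraticForm : Geometry.IsQuadraticForm 𝔽 (suc (suc n)) Q)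
  (nondegenerate : Geometry.Nondegenerate 𝔽 (suc (suc n)) Q) (1≤n : 1 ℕ.≤ n) where

  open ≡ using (refl; sym; trans; cong; module ≡-Reasoning)
  open FiniteField 𝔽 using (_+_; _*_; 0#; 1#; 2#; _≟_)
  open FieldProperties 𝔽
  open CommutativeRing ring using (*-comm)
  open IntegerCoefficientSolver ring
  open FormProperties 𝔽 2≢0 Q isQuadraticForm
  open Geometry 𝔽 (suc (suc n)) using (Point; Sphere)
  open ≡-Reasoning

  -- With `x` as base point, a nonzero parameter of another point on the sphere solves a linear
  -- equation with leading coefficient `Q v`, which has only one solution.
  line-meets-sphere-twice : ∀ {c r v x y z} → Q v ≢ 0# →
    ∃[ a ] y ≡ x +ᵥ a *ᵥ v → ∃[ b ] z ≡ x +ᵥ b *ᵥ v →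
    Sphere Q c r x → Sphere Q c r y → Sphere Q c r z → x ≡ y ⊎ x ≡ z ⊎ y ≡ z
  line-meets-sphere-twice {c} {_} {v} {x} Qv≢0 (a , refl) (b , refl) refl Sy Sz with a ≟ 0# | b ≟ 0#
  ... | yes refl | _        = inj₁ (sym (x+0y≡x x v))
  ... | no _     | yes refl = inj₂ (inj₁ (sym (x+0y≡x x v)))
  ... | no a≢0   | no b≢0   = inj₂ (inj₂ (cong (λ t → x +ᵥ t *ᵥ v) (*-cancelˡ Qv≢0 (begin
    Q v * a                                            ≡⟨ shuffle a ⟩
    a * Q v + 2# * ⟨ x -ᵥ c , v ⟩ - 2# * ⟨ x -ᵥ c , v ⟩
      ≡⟨ cong (_- 2# * ⟨ x -ᵥ c , v ⟩) (trans (root a≢0 Sy) (sym (root b≢0 Sz))) ⟩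
    b * Q v + 2# * ⟨ x -ᵥ c , v ⟩ - 2# * ⟨ x -ᵥ c , v ⟩ ≡⟨ shuffle b ⟨
    Q v * b                                            ∎))))
    where
    open FiniteField 𝔽 using (_-_)
    shuffle : ∀ t → Q v * t ≡ t * Q v + 2# * ⟨ x -ᵥ c , v ⟩ - 2# * ⟨ x -ᵥ c , v ⟩
    shuffle t = solve 3 (λ s t u → s :* t := t :* s :+ u :- u) refl (Q v) t (2# * ⟨ x -ᵥ c , v ⟩)

    root : ∀ {t} → t ≢ 0# → Sphere Q c (Q (x -ᵥ c)) (x +ᵥ t *ᵥ v) → t * Q v + 2# * ⟨ x -ᵥ c , v ⟩ ≡ 0#
    root {t} t≢0 St = x*y≡0⇒x≡0 (trans (*-comm _ t) (x≡x+y⇒y≡0 (sym (begin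
      Q (x -ᵥ c) + t * (t * Q v + 2# * ⟨ x -ᵥ c , v ⟩)  ≡⟨ Q-affine t (x -ᵥ c) v ⟨
      Q ((x -ᵥ c) +ᵥ t *ᵥ v)                            ≡⟨ cong Q ([x+ay]-z≡[x-z]+ay t x v c) ⟨
      Q ((x +ᵥ t *ᵥ v) -ᵥ c)                            ≡⟨ St ⟩
      Q (x -ᵥ c)                                        ∎)))) t≢0

  -- Both spheres together confine the points to one level set of ⟨u, ·⟩, where projecting along w
  -- loses nothing. As v lies in u^⊥, its lines stay in the level set, so the second projection
  -- identifies only points on a line in direction v, at most two of which are on the sphere.
  length-sphere∩sphere : ∀ {c r c′ r′} → c ≢ c′ → {xs : List Point} → Unique xs →
    (∀ {x} → x ∈ˡ xs → Sphere Q c r x) → (∀ {x} → x ∈ˡ xs → Sphere Q c′ r′ x) →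
    length xs ℕ.≤ q ℕ.^ n ℕ.* 2
  length-sphere∩sphere {c} {r} {c′} c≢c′ {xs} xs! S S′ =
    decidable-stable (length xs ℕ.≤? q ℕ.^ n ℕ.* 2) λ ≰ →
      nondegenerate-pairing nondegenerate (x≢y⇒y-x≢0ᵥ c≢c′) λ w ⟨u,w⟩≢0 →
        -- If the bound failed, no v in u^⊥ could have Q v ≠ 0. Then q^d ≤ q^2, which contradicts d
        -- ≥ 3.
        ℕ.<⇒≱ (ℕ.^-monoʳ-< q 2≤q (s≤s (s≤s 1≤n)))
          (isotropic-hyperplane nondegenerate ⟨u,w⟩≢0 λ v ⟨u,v⟩≡0 →
            decidable-stable (Q v ≟ 0#) λ Qv≢0 → ≰ (bound ⟨u,w⟩≢0 ⟨u,v⟩≡0 Qv≢0))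
    where
    u = c′ -ᵥ c

    level : ∀ {x y} → x ∈ˡ xs → y ∈ˡ xs → ⟨ u , x ⟩ ≡ ⟨ u , y ⟩
    level x∈ y∈ = radicalHyperplane-level
      (spheres⇒radicalHyperplane (S x∈) (S′ x∈)) (spheres⇒radicalHyperplane (S y∈) (S′ y∈))

    bound : ∀ {v w} → ⟨ u , w ⟩ ≢ 0# → ⟨ u , v ⟩ ≡ 0# → Q v ≢ 0# → length xs ℕ.≤ q ℕ.^ n ℕ.* 2
    bound {v} {w} ⟨u,w⟩≢0 ⟨u,v⟩≡0 Qv≢0 = length≤-two-to-one (encode ∘ ρ.π ∘ π.π) xs! coincide
      where
      module π = Projection (project w (⟨u,w⟩≢0⇒w≢0 {u} ⟨u,w⟩≢0))

      ⟨u,x+av⟩≡⟨u,x⟩ : ∀ a x → ⟨ u , x +ᵥ a *ᵥ v ⟩ ≡ ⟨ u , x ⟩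
      ⟨u,x+av⟩≡⟨u,x⟩ a x = begin
        ⟨ u , x +ᵥ a *ᵥ v ⟩         ≡⟨ ⟨,⟩-affineʳ a x v u ⟩
        ⟨ u , x ⟩ + a * ⟨ u , v ⟩   ≡⟨ cong (λ t → ⟨ u , x ⟩ + a * t) ⟨u,v⟩≡0 ⟩
        ⟨ u , x ⟩ + a * 0#          ≡⟨ solve 2 (λ s a → s :+ a :* con ℤ.0ℤ := s) refl ⟨ u , x ⟩ a ⟩
        ⟨ u , x ⟩                   ∎

      π-injective-on-levels : ∀ {x y} → ⟨ u , x ⟩ ≡ ⟨ u , y ⟩ → π.π x ≡ π.π y → y ≡ x
      π-injective-on-levels ⟨u,x⟩≡⟨u,y⟩ eq =
        let _ , y≡x+aw = π.π-fibre eq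
        in trans y≡x+aw (transversal ⟨u,w⟩≢0 (trans ⟨u,x⟩≡⟨u,y⟩ (cong ⟨ u ,_⟩ y≡x+aw)))

      πv≢0 : π.π v ≢ 0ᵥ
      -- Both v and 0 lie on level 0, where the first projection is injective, so a zero image would
      -- force v = 0.
      πv≢0 πv≡0 = Qv≢0 (begin
        Q v               ≡⟨ cong Q (0+1x≡xᵥ v) ⟨
        Q (0ᵥ +ᵥ 1# *ᵥ v) ≡⟨ cong Q (π-injective-on-levels (sym (⟨u,x+av⟩≡⟨u,x⟩ 1# 0ᵥ)) (sym (begin
          π.π (0ᵥ +ᵥ 1# *ᵥ v)        ≡⟨ π.π-affine 1# 0ᵥ v ⟩
          π.π 0ᵥ +ᵥ 1# *ᵥ π.π v      ≡⟨ cong (λ z → π.π 0ᵥ +ᵥ 1# *ᵥ z) πv≡0 ⟩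
          π.π 0ᵥ +ᵥ 1# *ᵥ 0ᵥ         ≡⟨ x+a0≡xᵥ 1# (π.π 0ᵥ) ⟩
          π.π 0ᵥ                     ∎))) ⟩
        Q 0ᵥ              ≡⟨ Q0≡0 ⟩
        0#                ∎)

      module ρ = Projection (project (π.π v) πv≢0)

      collinear : ∀ {x y} → x ∈ˡ xs → y ∈ˡ xs → encode (ρ.π (π.π x)) ≡ encode (ρ.π (π.π y)) →
        ∃[ a ] y ≡ x +ᵥ a *ᵥ v
      collinear {x} x∈ y∈ eq =
        let a , πy≡πx+aπv = ρ.π-fibre (encode-injective eq)
        in a , π-injective-on-levels (trans (⟨u,x+av⟩≡⟨u,x⟩ a x) (level x∈ y∈))
                 (trans (π.π-affine a x v) (sym πy≡πx+aπv))

      coincide : ∀ {x y z} → x ∈ˡ xs → y ∈ˡ xs → z ∈ˡ xs → encode (ρ.π (π.π x)) ≡ encode (ρ.π (π.π y)) →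
        encode (ρ.π (π.π x)) ≡ encode (ρ.π (π.π z)) → x ≡ y ⊎ x ≡ z ⊎ y ≡ z
      coincide x∈ y∈ z∈ xy xz = line-meets-sphere-twice Qv≢0
        (collinear x∈ y∈ xy) (collinear x∈ z∈ xz) (S x∈) (S y∈) (S z∈)

-- Real inequalities without a decidable order, and the estimate of the bound

module RealProperties {c ℓ₁ ℓ₂ ℓ₃} (ℝ : RealNumbers c ℓ₁ ℓ₂ ℓ₃) where
  open RealNumbers ℝ
  open RealLemmas ℝ
  open IntegerCoefficientSolver commutativeRing
  open IsStrictPartialOrder <-isStrictPartialOrder using ()
    renaming (irrefl to <-irrefl; trans to <-trans; <-respʳ-≈ to <-respʳ-≈; <-respˡ-≈ to <-respˡ-≈)
  open SemiringMult semiring using (×1-homo-*; ×-homo-+)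
  open SetoidReasoning (CommutativeRing.setoid commutativeRing)

  <⇒≤ : ∀ {x y} → x < y → x ≤ y
  <⇒≤ x<y y<x = <-irrefl refl (<-trans x<y y<x)

  ≈⇒≤ : ∀ {x y} → x ≈ y → x ≤ y
  ≈⇒≤ x≈y y<x = <-irrefl (sym x≈y) y<x

  ≤-refl : ∀ {x} → x ≤ x
  ≤-refl = ≈⇒≤ refl

  ≤-resp-≈ : ∀ {x x′ y y′} → x ≈ x′ → y ≈ y′ → x ≤ y → x′ ≤ y′
  ≤-resp-≈ x≈x′ y≈y′ x≤y y′<x′ = x≤y (<-respˡ-≈ (sym y≈y′) (<-respʳ-≈ (sym x≈x′) y′<x′))

  -- Since `y ≤ z` is only a negation, cotransitivity of apartness first separates `z` from `x` or
  -- from `y`.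
  <-≤-trans : ∀ {x y z} → x < y → y ≤ z → x < z
  <-≤-trans {x} {y} {z} x<y y≤z with #-cotrans (<⇒# x<y) z
  ... | inj₂ z#y with #⇒<⊎> z#y
  ...   | inj₁ z<y = contradiction z<y y≤z
  ...   | inj₂ y<z = <-trans x<y y<z
  <-≤-trans {x} {y} {z} x<y y≤z | inj₁ x#z with #⇒<⊎> x#z
  ...   | inj₁ x<z = x<z
  ...   | inj₂ z<x = contradiction (<-trans z<x x<y) y≤z

  ≤-<-trans : ∀ {x y z} → x ≤ y → y < z → x < z
  ≤-<-trans {x} {y} {z} x≤y y<z with #-cotrans (<⇒# y<z) x
  ... | inj₁ y#x with #⇒<⊎> y#x
  ...   | inj₁ y<x = contradiction y<x x≤y
  ...   | inj₂ x<y = <-trans x<y y<z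
  ≤-<-trans {x} {y} {z} x≤y y<z | inj₂ x#z with #⇒<⊎> x#z
  ...   | inj₁ x<z = x<z
  ...   | inj₂ z<x = contradiction (<-trans y<z z<x) x≤y

  ≤-trans : ∀ {x y z} → x ≤ y → y ≤ z → x ≤ z
  ≤-trans x≤y y≤z z<x = y≤z (<-≤-trans z<x x≤y)

  -- Trichotomy holds up to double negation, which is enough to prove the negative statement x ≤ y.
  ¬¬-tri : ∀ x y → ¬ (¬ (x < y) × ¬ (x ≈ y) × ¬ (y < x))
  ¬¬-tri x y (x≮y , x≉y , y≮x) =
    x≉y (proj₁ (tight x y) λ x#y → [ x≮y , y≮x ]′ (#⇒<⊎> x#y))

  0<y-x : ∀ {x y} → x < y → 0# < y - x
  0<y-x {x} x<y = <-respˡ-≈ (-‿inverseʳ x) (+-monoˡ-< (- x) x<y)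

  0≤y-x⇒x≤y : ∀ {x y} → 0# ≤ y - x → x ≤ y
  0≤y-x⇒x≤y {x} {y} 0≤y-x y<x = 0≤y-x (<-respʳ-≈ (-‿inverseʳ x) (+-monoˡ-< (- x) y<x))

  *-monoʳ-< : ∀ {x y z} → 0# < x → y < z → x * y < x * z
  *-monoʳ-< {x} {y} {z} 0<x y<z = <-respʳ-≈
    (solve 3 (λ x y z → x :* (z :- y) :+ x :* y := x :* z) refl x y z)
    (<-respˡ-≈ (+-identityˡ (x * y)) (+-monoˡ-< (x * y) (*-pos 0<x (0<y-x y<z))))

  *-monoʳ-≤ : ∀ {x y z} → 0# ≤ x → y ≤ z → x * y ≤ x * z
  *-monoʳ-≤ {x} {y} {z} 0≤x y≤z xz<xy = ¬¬-tri y z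
    ( (λ y<z → ¬¬-tri 0# x
        ( (λ 0<x → <-irrefl refl (<-trans xz<xy (*-monoʳ-< 0<x y<z)))
        , (λ 0≈x → <-irrefl (begin
            x * z   ≈⟨ *-congʳ 0≈x ⟨
            0# * z  ≈⟨ zeroˡ z ⟩
            0#      ≈⟨ zeroˡ y ⟨
            0# * y  ≈⟨ *-congʳ 0≈x ⟩
            x * y   ∎) xz<xy)
        , 0≤x))
    , (λ y≈z → <-irrefl (*-congˡ (sym y≈z)) xz<xy)
    , y≤z)

  *-monoˡ-≤ : ∀ {x y z} → 0# ≤ x → y ≤ z → y * x ≤ z * x
  *-monoˡ-≤ {x} {y} {z} 0≤x y≤z = ≤-resp-≈ (*-comm x y) (*-comm x z) (*-monoʳ-≤ 0≤x y≤z)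

  *-mono-≤ : ∀ {w x y z} → 0# ≤ y → 0# ≤ x → w ≤ x → y ≤ z → w * y ≤ x * z
  *-mono-≤ 0≤y 0≤x w≤x y≤z = ≤-trans (*-monoˡ-≤ 0≤y w≤x) (*-monoʳ-≤ 0≤x y≤z)

  *-nonneg : ∀ {x y} → 0# ≤ x → 0# ≤ y → 0# ≤ x * y
  *-nonneg {x} 0≤x 0≤y = ≤-resp-≈ (zeroʳ x) refl (*-monoʳ-≤ 0≤x 0≤y)

  *-cancelˡ-≤ : ∀ {x y z} → 0# < x → x * y ≤ x * z → y ≤ z
  *-cancelˡ-≤ 0<x xy≤xz z<y = xy≤xz (*-monoʳ-< 0<x z<y)

  0≤ι : ∀ n → 0# ≤ ι n
  0≤ι zero    = ≤-refl
  0≤ι (suc n) = <⇒≤ (ι-pos (suc n))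

  ι-mono-≤ : ∀ {m n} → m ℕ.≤ n → ι m ≤ ι n
  ι-mono-≤ {m} {n} m≤n = 0≤y-x⇒x≤y (≤-resp-≈ refl (begin
    ι (n ℕ.∸ m)                   ≈⟨ solve 2 (λ x y → x := y :+ x :- y) refl (ι (n ℕ.∸ m)) (ι m) ⟩
    ι m + ι (n ℕ.∸ m) - ι m       ≈⟨ +-congʳ (×-homo-+ 1# m (n ℕ.∸ m)) ⟨
    ι (m ℕ.+ (n ℕ.∸ m)) - ι m     ≡⟨ ≡.cong (λ k → ι k - ι m) (ℕ.m+[n∸m]≡n m≤n) ⟩
    ι n - ι m                     ∎) (0≤ι (n ℕ.∸ m)))

  ι-* : ∀ m n → ι (m ℕ.* n) ≈ ι m * ι n
  ι-* = ×1-homo-*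

  /-* : ∀ x {y} (y#0 : y # 0#) → x / y [ y#0 ] * y ≈ x
  /-* x {y} y#0 with #⇒invertible y#0
  ... | z , z[y-0]≈1 , _ = begin
    -- Invertibility is supplied for the difference y - 0 that witnesses apartness from zero.
    x * z * y           ≈⟨ solve 3 (λ x y z → x :* z :* y := x :* (z :* (y :- con ℤ.0ℤ))) refl x y z ⟩
    x * (z * (y - 0#))  ≈⟨ *-congˡ z[y-0]≈1 ⟩
    x * 1#              ≈⟨ *-identityʳ x ⟩
    x                   ∎

  /-≤ : ∀ {x y z} (y#0 : y # 0#) → 0# < y → x ≤ y * z → x / y [ y#0 ] ≤ z
  /-≤ {x} {y} {z} y#0 0<y x≤yz = *-cancelˡ-≤ 0<y
    (≤-resp-≈ (trans (sym (/-* x y#0)) (*-comm (x / y [ y#0 ]) y)) refl x≤yz)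

  ι/ι≤ι : ∀ a b n (ιb#0 : ι b # 0#) → a ℕ.≤ b ℕ.* n → ι a / ι b [ ιb#0 ] ≤ ι n
  ι/ι≤ι a b n ιb#0 a≤bn = /-≤ ιb#0 0<ιb (≤-resp-≈ refl (ι-* b n) (ι-mono-≤ a≤bn))
    where
    0<ιb : 0# < ι b
    0<ιb with #⇒<⊎> ιb#0
    ... | inj₁ ιb<0 = contradiction ιb<0 (0≤ι b)
    ... | inj₂ 0<ιb = 0<ιb

  /-nonneg : ∀ {x y} (y#0 : y # 0#) → 0# < y → 0# ≤ x → 0# ≤ x / y [ y#0 ]
  /-nonneg {x} {y} y#0 0<y 0≤x = *-cancelˡ-≤ 0<y
    (≤-resp-≈ (sym (zeroʳ y)) (trans (sym (/-* x y#0)) (*-comm (x / y [ y#0 ]) y)) 0≤x)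

  square-cancel-≤ : ∀ {x y} → 0# ≤ y → x * x ≤ y * y → x ≤ y
  square-cancel-≤ {x} {y} 0≤y xx≤yy y<x = xx≤yy
    (≤-<-trans (*-monoʳ-≤ 0≤y (<⇒≤ y<x)) (<-respʳ-≈ refl
      (<-respˡ-≈ (*-comm x y) (*-monoʳ-< (≤-<-trans 0≤y y<x) y<x))))

  -- Squaring turns the claim into 64 β⁴ q⁴ b² ≤ α⁴ N² ≤ N² ≤ 64 β⁴ q⁴ n², where β = 1 − α, b is the
  -- bound, and the first step is the hypothesis relating m and N.
  module Bound {α C m N q : Carrier}
    (0<α : 0# < α) (α<1 : α < 1#) (1≤C : 1# ≤ C) (0≤m : 0# ≤ m) (0≤N : 0# ≤ N)
    (0<q : 0# < q) (q#0 : q # 0#)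
    (large : (1# - α) ^ 3 * m * q ^ 3 ≤ C ^ 2 * α ^ 2 * N) {mN : Carrier} (mN≈m*N : mN ≈ m * N)
    where

    -- `mN` is separate from the product `m * N` so that `bound` unfolds to the expression of the
    -- theorem, where the product under the root is formed in the natural numbers.
    bound : Carrier
    bound = (α / (ι 8 * C * √ (1# - α)) [ 8C√[1-α]#0 α<1 1≤C ]) * √ (mN / q [ q#0 ])

    private
      β s w b 64# : Carrier
      β = 1# - α
      s = √ β
      w = √ (mN / q [ q#0 ])
      b = bound
      64# = ι 8 * ι 8

      0<β : 0# < β
      0<β = 0<y-x α<1

      0<C : 0# < C
      0<C = <-≤-trans 0<1 1≤C

      s*s≈β : s * s ≈ β
      s*s≈β = √² (<⇒≤ 0<β)

      w*w*q≈m*N : w * w * q ≈ m * N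
      w*w*q≈m*N = begin
        w * w * q
          ≈⟨ *-congʳ (√² (/-nonneg q#0 0<q (≤-resp-≈ refl (sym mN≈m*N) (*-nonneg 0≤m 0≤N)))) ⟩
        mN / q [ q#0 ] * q    ≈⟨ /-* mN q#0 ⟩
        mN                    ≈⟨ mN≈m*N ⟩
        m * N                 ∎

      b*8Cs≈αw : b * (ι 8 * C * s) ≈ α * w
      b*8Cs≈αw = begin
        a * w * (ι 8 * C * s)  ≈⟨ solve 3 (λ a w y → a :* w :* y := a :* y :* w) refl a w (ι 8 * C * s) ⟩
        a * (ι 8 * C * s) * w  ≈⟨ *-congʳ (/-* α (8C√[1-α]#0 α<1 1≤C)) ⟩
        α * w                  ∎
        where a = α / (ι 8 * C * √ (1# - α)) [ 8C√[1-α]#0 α<1 1≤C ]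

      64C²βq*b²≈α²mN : 64# * (C * C) * β * q * (b * b) ≈ α * α * (m * N)
      64C²βq*b²≈α²mN = begin
        64# * (C * C) * β * q * (b * b)                  ≈⟨ *-congʳ (*-congʳ (*-congˡ s*s≈β)) ⟨
        64# * (C * C) * (s * s) * q * (b * b)
          ≈⟨ solve 5 (λ e C s q b →
               e :* e :* (C :* C) :* (s :* s) :* q :* (b :* b) :=
               b :* (e :* C :* s) :* (b :* (e :* C :* s)) :* q) refl (ι 8) C s q b ⟩
        b * (ι 8 * C * s) * (b * (ι 8 * C * s)) * q      ≈⟨ *-congʳ (*-cong b*8Cs≈αw b*8Cs≈αw) ⟩
        α * w * (α * w) * q
          ≈⟨ solve 3 (λ α w q → α :* w :* (α :* w) :* q := α :* α :* (w :* w :* q)) refl α w q ⟩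
        α * α * (w * w * q)                              ≈⟨ *-congˡ w*w*q≈m*N ⟩
        α * α * (m * N)                                  ∎

      α²≤1 : α * α ≤ 1#
      α²≤1 = ≤-resp-≈ refl (*-identityˡ 1#) (*-mono-≤ (<⇒≤ 0<α) (<⇒≤ 0<1) (<⇒≤ α<1) (<⇒≤ α<1))

      α²N≤N : α * α * N ≤ N
      α²N≤N = ≤-resp-≈ refl (*-identityˡ N) (*-monoˡ-≤ 0≤N α²≤1)

      0≤α²N : 0# ≤ α * α * N
      0≤α²N = *-nonneg (*-nonneg (<⇒≤ 0<α) (<⇒≤ 0<α)) 0≤N

      -- Multiplying `large` by α² N produces the factor α² m N, whose value in terms of b² is known
      -- exactly. The factor C² stays on both sides and is cancelled in `bound≤`.
      C²*64β⁴q⁴b²≤C²*N² :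
        C * C * (64# * (β * q * (β * q)) * (β * q * (β * q)) * (b * b)) ≤ C * C * (N * N)
      C²*64β⁴q⁴b²≤C²*N² = ≤-trans
        (≤-resp-≈
          (begin
            α * α * N * (β ^ 3 * m * q ^ 3)
              ≈⟨ solve 5 (λ α N β m q →
                   α :* α :* N :* (β :* (β :* (β :* con 1ℤ)) :* m :* (q :* (q :* (q :* con 1ℤ)))) :=
                   α :* α :* (m :* N) :* (β :* β :* β :* q :* q :* q)) refl α N β m q ⟩
            α * α * (m * N) * (β * β * β * q * q * q)
              ≈⟨ *-congʳ 64C²βq*b²≈α²mN ⟨
            64# * (C * C) * β * q * (b * b) * (β * β * β * q * q * q)
              ≈⟨ solve 5 (λ e C β q b →
                   e :* (C :* C) :* β :* q :* (b :* b) :* (β :* β :* β :* q :* q :* q) :=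
                   C :* C :* (e :* (β :* q :* (β :* q)) :* (β :* q :* (β :* q)) :* (b :* b))) refl
                   64# C β q b ⟩
            C * C * (64# * (β * q * (β * q)) * (β * q * (β * q)) * (b * b)) ∎)
          (solve 3 (λ C α N → α :* α :* N :* (C :* (C :* con 1ℤ) :* (α :* (α :* con 1ℤ)) :* N) :=
             C :* C :* ((α :* α :* N) :* (α :* α :* N))) refl C α N)
          (*-monoʳ-≤ 0≤α²N large))
        (*-monoʳ-≤ (*-nonneg (<⇒≤ 0<C) (<⇒≤ 0<C)) (*-mono-≤ 0≤α²N 0≤N α²N≤N α²N≤N))

    bound≤ : ∀ {n D D′} → 0# ≤ n → 0# ≤ D → 0# ≤ D′ → D ≤ β * q → D′ ≤ β * q →
      N ≤ ι 8 * (D * D′) * n → bound ≤ n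
    bound≤ {n} {D} {D′} 0≤n 0≤D 0≤D′ D≤βq D′≤βq N≤8DD′n = square-cancel-≤ 0≤n
      (*-cancelˡ-≤ 0<64β⁴q⁴ (≤-trans
        (*-cancelˡ-≤ (*-pos 0<C 0<C) C²*64β⁴q⁴b²≤C²*N²)
        (≤-resp-≈ refl
          (solve 3 (λ e x n → e :* x :* n :* (e :* x :* n) := e :* e :* x :* x :* (n :* n)) refl
            (ι 8) (β * q * (β * q)) n)
          (*-mono-≤ 0≤N (≤-trans 0≤N N≤8[βq]²n) N≤8[βq]²n N≤8[βq]²n))))
      where
      0<βq = *-pos 0<β 0<q
      0<64β⁴q⁴ : 0# < 64# * (β * q * (β * q)) * (β * q * (β * q))
      0<64β⁴q⁴ = *-pos (*-pos (*-pos (ι-pos 8) (ι-pos 8)) (*-pos 0<βq 0<βq)) (*-pos 0<βq 0<βq)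
      N≤8[βq]²n : N ≤ ι 8 * (β * q * (β * q)) * n
      N≤8[βq]²n = ≤-trans N≤8DD′n (*-monoˡ-≤ 0≤n (*-monoʳ-≤ (0≤ι 8)
        (*-mono-≤ 0≤D′ (<⇒≤ 0<βq) D≤βq D′≤βq)))

-- Cells of a pair of pins, and the number of heavy choices

module PinnedSpheres {q : ℕ} (𝔽 : FiniteField q) {d : ℕ}
  (Q : Vec (FiniteField.Carrier 𝔽) d → FiniteField.Carrier 𝔽)
  (P T : Finset (Vec (FiniteField.Carrier 𝔽) d)) where

  open ListAction using (sum)
  open ≡ using (refl; sym; trans; cong; subst)
  open FiniteField 𝔽 using (Carrier; _≟_)
  open Geometry 𝔽 d using (Point; _-ᵥ_; Δ; S; Sphere; Choice; Admissible)
  open ℕ.≤-Reasoning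

  Radii : Set
  Radii = Carrier × Carrier

  cell : Point → Point → Radii → Finset Point
  cell p p′ (t , t′) = P ∩[ S Q p t ] ∩[ S Q p′ t′ ]

  radii : Point → Point → List Radii
  radii p p′ = cartesianProduct (elements (Δ Q p P)) (elements (Δ Q p′ P))

  bothSpheres? : ∀ p p′ ((t , t′) : Radii) → Decidable (λ x → Sphere Q p t x × Sphere Q p′ t′ x)
  bothSpheres? p p′ (t , t′) x = S Q p t x ×-dec S Q p′ t′ x

  cell≡ : ∀ p p′ y → elements (cell p p′ y) ≡ filter (bothSpheres? p p′ y) (elements P)
  cell≡ p p′ (t , t′) = filter-filter (S Q p t) (S Q p′ t′) (elements P)

  0<length⇒∃∈ : ∀ {a} {A : Set a} (xs : List A) → 0 ℕ.< length xs → ∃[ x ] x ∈ˡ xs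
  0<length⇒∃∈ (x ∷ _) _ = x , here refl

  ∈-cell⁻ : ∀ p p′ {t t′ x} → x ∈ cell p p′ (t , t′) → Sphere Q p t x × Sphere Q p′ t′ x
  ∈-cell⁻ p p′ {t} {t′} x∈ =
    let x∈P∩S , S′x = ∈-filter⁻ (S Q p′ t′) {xs = elements (P ∩[ S Q p t ])} x∈
    in proj₂ (∈-filter⁻ (S Q p t) {xs = elements P} x∈P∩S) , S′x

  distance∈Δ : ∀ p {x} → x ∈ P → Q (x -ᵥ p) ∈ Δ Q p P
  distance∈Δ p x∈P = ∈-deduplicate⁺ _≟_ (∈-map⁺ (λ x → Q (x -ᵥ p)) x∈P)

  distances∈radii : ∀ p p′ {x} → x ∈ P → (Q (x -ᵥ p) , Q (x -ᵥ p′)) ∈ˡ radii p p′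
  distances∈radii p p′ x∈P = ∈-cartesianProduct⁺ (distance∈Δ p x∈P) (distance∈Δ p′ x∈P)

  cells-cover : ∀ p p′ → ∣ P ∣ ℕ.≤ sum (map (∣_∣ ∘ cell p p′) (radii p p′))
  cells-cover p p′ = begin
    ∣ P ∣
      ≤⟨ length≤sum-filters (bothSpheres? p p′) (radii p p′) (elements P)
           (λ x∈P → lose (distances∈radii p p′ x∈P) (refl , refl)) ⟩
    sum (map (λ y → length (filter (bothSpheres? p p′ y) (elements P))) (radii p p′))
      ≤⟨ sum-map-mono-≤ (λ y → ℕ.≤-reflexive (cong length (sym (cell≡ p p′ y)))) (radii p p′) ⟩
    sum (map (∣_∣ ∘ cell p p′) (radii p p′)) ∎

  HeavyAt : Point → Point → Radii → Set
  HeavyAt p p′ = Heavy (∣_∣ ∘ cell p p′) ∣ P ∣ (length (radii p p′))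

  heavyAt? : ∀ p p′ → Decidable (HeavyAt p p′)
  heavyAt? p p′ = heavy? (∣_∣ ∘ cell p p′) ∣ P ∣ (length (radii p p′))

  heavyRadii : Point → Point → List Radii
  heavyRadii p p′ = filter (heavyAt? p p′) (radii p p′)

  _≟ᵥ_ = Vec.≡-dec {n = d} _≟_

  otherPins : Point → List Point
  otherPins p = filter (λ p′ → ¬? (p ≟ᵥ p′)) (elements T)

  choicesAt : Point → Point → List (Choice Q)
  choicesAt p p′ = map (λ (t , t′) → (p , t) , (p′ , t′)) (heavyRadii p p′)

  choicesFrom : Point → List (Choice Q)
  choicesFrom p = concatMap (choicesAt p) (otherPins p)

  choices : List (Choice Q)
  choices = concatMap choicesFrom (elements T)

  choicesAt-pins : ∀ p p′ {x} → x ∈ˡ choicesAt p p′ → proj₁ (proj₁ x) ≡ p × proj₁ (proj₂ x) ≡ p′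
  choicesAt-pins p p′ x∈ with _ , _ , refl ← ∈-map⁻ _ x∈ = refl , refl

  choicesFrom-pin : ∀ p {x} → x ∈ˡ choicesFrom p → proj₁ (proj₁ x) ≡ p
  choicesFrom-pin p x∈ =
    let p′ , _ , x∈at = find (∈-concatMap⁻ (choicesAt p) {xs = otherPins p} x∈)
    in proj₁ (choicesAt-pins p p′ x∈at)

  choices-unique : Unique choices
  choices-unique = concatMap-unique choicesFrom (proj₁ ∘ proj₁) (λ {p} → choicesFrom-pin p)
    (λ p → concatMap-unique (choicesAt p) (proj₁ ∘ proj₂) (λ {p′} → proj₂ ∘ choicesAt-pins p p′)
      (λ p′ → Unique.map⁺ (λ { refl → refl })
        (Unique.filter⁺ (heavyAt? p p′)
          (Unique.cartesianProduct⁺ (distinct (Δ Q p P)) (distinct (Δ Q p′ P)))))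
      (Unique.filter⁺ (λ p′ → ¬? (p ≟ᵥ p′)) (distinct T)))
    (distinct T)

  heavyChoices : Finset (Choice Q)
  heavyChoices = ⟪ choices , choices-unique ⟫

  ∈-heavyChoices⁻ : ∀ {p t p′ t′} → ((p , t) , (p′ , t′)) ∈ heavyChoices →
    Admissible Q P T ((p , t) , (p′ , t′)) × HeavyAt p p′ (t , t′)
  ∈-heavyChoices⁻ x∈ with find (∈-concatMap⁻ choicesFrom {xs = elements T} x∈)
  ... | p , p∈T , x∈from with find (∈-concatMap⁻ (choicesAt p) {xs = otherPins p} x∈from)
  ... | p′ , p′∈others , x∈at with ∈-map⁻ _ x∈at
  ... | (t , t′) , t∈ , refl =
    let p′∈T , p≢p′ = ∈-filter⁻ (λ p′ → ¬? (p ≟ᵥ p′)) {xs = elements T} p′∈others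
        t∈radii , heavy = ∈-filter⁻ (heavyAt? p p′) {xs = radii p p′} t∈
        t∈Δ , t′∈Δ = ∈-cartesianProduct⁻ (elements (Δ Q p P)) (elements (Δ Q p′ P)) t∈radii
    in (p∈T , p′∈T , p≢p′ , t∈Δ , t′∈Δ) , heavy

  -- The two counts differ only in `k`, which becomes q^(d-1) and, for d ≥ 3, 2 q^(d-2).
  module _ (P≢∅ : Nonempty P) {k : ℕ} (cell≤k : ∀ {p p′} → p ≢ p′ → ∀ y → ∣ cell p p′ y ∣ ℕ.≤ k) where

    many-heavyRadii : ∀ {p p′} → p ≢ p′ → 7 ℕ.* ∣ P ∣ ℕ.≤ 8 ℕ.* k ℕ.* length (heavyRadii p p′)
    many-heavyRadii {p} {p′} p≢p′ =
      many-heavy (∣_∣ ∘ cell p p′) (cell≤k p≢p′) (radii p p′)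
        {{ℕ.>-nonZero (∈-length (distances∈radii p p′ (proj₂ P≢∅)))}} (cells-cover p p′)

    many-choicesFrom : ∀ p → 7 ℕ.* ∣ P ∣ ℕ.* (∣ T ∣ ℕ.∸ 1) ℕ.≤ 8 ℕ.* k ℕ.* length (choicesFrom p)
    many-choicesFrom p = begin
      7 ℕ.* ∣ P ∣ ℕ.* (∣ T ∣ ℕ.∸ 1)
        ≤⟨ ℕ.*-monoʳ-≤ (7 ℕ.* ∣ P ∣) (ℕ.∸-monoˡ-≤ 1 (length≤1+length-filter-≢ _≟ᵥ_ p (distinct T))) ⟩
      7 ℕ.* ∣ P ∣ ℕ.* length (otherPins p)
        ≤⟨ concatMap-length {k = 8 ℕ.* k} (choicesAt p) (otherPins p) many-choicesAt ⟩
      8 ℕ.* k ℕ.* length (choicesFrom p)        ∎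
      where
      many-choicesAt : ∀ {p′} → p′ ∈ˡ otherPins p → 7 ℕ.* ∣ P ∣ ℕ.≤ 8 ℕ.* k ℕ.* length (choicesAt p p′)
      many-choicesAt {p′} p′∈ = subst (λ l → 7 ℕ.* ∣ P ∣ ℕ.≤ 8 ℕ.* k ℕ.* l)
        (sym (length-map _ (heavyRadii p p′)))
        (many-heavyRadii (proj₂ (∈-filter⁻ (λ p′ → ¬? (p ≟ᵥ p′)) {xs = elements T} p′∈)))

    many-choices : 3 ℕ.* ∣ P ∣ ℕ.* ∣ T ∣ ℕ.* (∣ T ∣ ℕ.∸ 1) ℕ.≤ 4 ℕ.* k ℕ.* ∣ heavyChoices ∣
    many-choices = ℕ.*-cancelˡ-≤ 2 (begin
      -- One of the seven copies of N m (m - 1) is given up here, which turns 7/8 into 3/4.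
      2 ℕ.* (3 ℕ.* N ℕ.* m ℕ.* m-1)              ≤⟨ ℕ.m≤m+n _ (N ℕ.* m ℕ.* m-1) ⟩
      2 ℕ.* (3 ℕ.* N ℕ.* m ℕ.* m-1) ℕ.+ N ℕ.* m ℕ.* m-1 ≡⟨ sixfold+onefold N m m-1 ⟩
      7 ℕ.* N ℕ.* m-1 ℕ.* m
        ≤⟨ concatMap-length {k = 8 ℕ.* k} choicesFrom (elements T) (λ {p} _ → many-choicesFrom p) ⟩
      8 ℕ.* k ℕ.* ∣ heavyChoices ∣               ≡⟨ eightfold k ∣ heavyChoices ∣ ⟩
      2 ℕ.* (4 ℕ.* k ℕ.* ∣ heavyChoices ∣)       ∎)
      where
      N = ∣ P ∣
      m = ∣ T ∣
      m-1 = ∣ T ∣ ℕ.∸ 1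
      sixfold+onefold : ∀ a b c → 2 ℕ.* (3 ℕ.* a ℕ.* b ℕ.* c) ℕ.+ a ℕ.* b ℕ.* c ≡ 7 ℕ.* a ℕ.* c ℕ.* b
      sixfold+onefold = solve-∀
      eightfold : ∀ a b → 8 ℕ.* a ℕ.* b ≡ 2 ℕ.* (4 ℕ.* a ℕ.* b)
      eightfold = solve-∀

    -- Two pins and one point make the lower bound of `many-choices` positive.
    heavyChoices-nonempty : 2 ℕ.≤ ∣ T ∣ → Nonempty heavyChoices
    heavyChoices-nonempty 2≤∣T∣ = 0<length⇒∃∈ choices (ℕ.n≢0⇒n>0 λ ∣G∣≡0 → ℕ.<⇒≱ 0<3Nm[m-1] (begin
      3 ℕ.* ∣ P ∣ ℕ.* ∣ T ∣ ℕ.* (∣ T ∣ ℕ.∸ 1)  ≤⟨ many-choices ⟩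
      4 ℕ.* k ℕ.* ∣ heavyChoices ∣           ≡⟨ cong (4 ℕ.* k ℕ.*_) ∣G∣≡0 ⟩
      4 ℕ.* k ℕ.* 0                          ≡⟨ ℕ.*-zeroʳ (4 ℕ.* k) ⟩
      0                                      ∎))
      where
      0<3Nm[m-1] : 0 ℕ.< 3 ℕ.* ∣ P ∣ ℕ.* ∣ T ∣ ℕ.* (∣ T ∣ ℕ.∸ 1)
      0<3Nm[m-1] = ℕ.*-mono-≤
        (ℕ.*-mono-≤ (ℕ.*-mono-≤ (s≤s (z≤n {2})) (∈-length (proj₂ P≢∅))) (ℕ.≤-trans (s≤s z≤n) 2≤∣T∣))
        (ℕ.∸-monoˡ-≤ 1 2≤∣T∣)

-- Rich choices: existence, radical hyperplane and number

theorem5p4 : ∀ {c ℓ₁ ℓ₂ ℓ₃} (ℝ : RealNumbers c ℓ₁ ℓ₂ ℓ₃) →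
  let open RealNumbers ℝ
      open RealLemmas ℝ
  in
  (q : ℕ) → OddPrimePower q → (𝔽 : FiniteField q) →
  (d : ℕ) → 2 ℕ.≤ d →
  let open Geometry 𝔽 d
      instance q≢0 = FiniteField.q≢0 𝔽
  in
  (Q : Point → Scalar) → IsQuadraticForm Q → Nondegenerate Q →
  (P : Finset Point) → Nonempty P →
  (T : Finset Point) → 2 ℕ.≤ ∣ T ∣ →
  let m = ∣ T ∣ in
  (α : Carrier) → 0# < α → (α<1 : α < 1#) →
  (∀ p → p ∈ T → ι ∣ Δ Q p P ∣ ≤ (1# - α) * ι q) →
  (C₁ : Carrier) (1≤C₁ : 1# ≤ C₁) →
  (1# - α) ^ 3 * ι m * ι q ^ 3 ≤ C₁ ^ 2 * α ^ 2 * ι ∣ P ∣ →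
  let bound : Carrier
      bound = (α / (ι 8 * C₁ * √ (1# - α)) [ 8C√[1-α]#0 α<1 1≤C₁ ])
                * √ (ι (m ℕ.* ∣ P ∣) / ι q [ ι#0 q ])

      Rich : Choice Q → Set _
      Rich = λ ((p , t) , (p′ , t′)) →
        bound ≤ ι ∣ P ∩[ S Q p t ] ∩[ S Q p′ t′ ] ∣
  in
  (∃[ p ] ∃[ p′ ] ∃[ t ] ∃[ t′ ]
     p ∈ T × p′ ∈ T × p ≢ p′ × t ∈ Δ Q p P × t′ ∈ Δ Q p′ P ×
     bound ≤ ι ∣ P ∩[ S Q p t ] ∩[ S Q p′ t′ ] ∣ ×
     bound ≤ ι ∣ P ∩[ H Q p t p′ t′ ] ∣)
  ×
  AtLeast (ι (3 ℕ.* ∣ P ∣ ℕ.* m ℕ.* (m ℕ.∸ 1))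
             / ι (4 ℕ.* q ℕ.^ (d ℕ.∸ 1)) [ ι#0 _ {{m*n≢0 4 _ {{_}} {{m^n≢0 q (d ℕ.∸ 1)}}}} ])
          (λ x → Admissible Q P T x × Rich x)
  ×
  (3 ℕ.≤ d →
   AtLeast (ι (3 ℕ.* ∣ P ∣ ℕ.* m ℕ.* (m ℕ.∸ 1))
              / ι (8 ℕ.* q ℕ.^ (d ℕ.∸ 2)) [ ι#0 _ {{m*n≢0 8 _ {{_}} {{m^n≢0 q (d ℕ.∸ 2)}}}} ])
           (λ x → Admissible Q P T x × Rich x))
theorem5p4 ℝ q odd 𝔽 d@(suc (suc n)) (s≤s (s≤s z≤n)) Q isQuadraticForm nondegenerate P P≢∅ T 2≤∣T∣
  α 0<α α<1 ∣Δ∣≤ C₁ 1≤C₁ large =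
  let ((p , t) , (p′ , t′)) , x∈G = heavyChoices-nonempty P≢∅ cell≤q^[d-1] 2≤∣T∣
      admissible , heavy = ∈-heavyChoices⁻ x∈G
      p∈T , p′∈T , p≢p′ , t∈Δ , t′∈Δ = admissible
      bound≤cell = rich admissible heavy
  in (p , p′ , t , t′ , p∈T , p′∈T , p≢p′ , t∈Δ , t′∈Δ , bound≤cell ,
       ≤-trans bound≤cell (ι-mono-≤ (cell≤∣P∩H∣ p p′ t t′))) ,
     atLeast (ι/ι≤ι _ (4 ℕ.* q ℕ.^ suc n) ∣ heavyChoices ∣ _ (many-choices P≢∅ cell≤q^[d-1])) ,
     -- The same choices are counted again; the factor 2 in the cell size turns the 4 of the
     -- denominator into 8.
     λ { (s≤s (s≤s 1≤n)) → atLeast (ι/ι≤ι _ (8 ℕ.* q ℕ.^ n) ∣ heavyChoices ∣ _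
           (ℕ.≤-trans (many-choices P≢∅ (cell≤2q^[d-2] 1≤n))
             (ℕ.≤-reflexive (cong (ℕ._* ∣ heavyChoices ∣) (4[x2]≡8x (q ℕ.^ n)))))) }
  where
  open ≡ using (refl; sym; cong; subst)
  open RealNumbers ℝ using (ι; _≤_)
  open RealLemmas ℝ using (AtLeast; ι#0; ι-pos)
  open RealProperties ℝ
  open Geometry 𝔽 d using (Δ; H; Admissible)
  open PinnedSpheres 𝔽 Q P T
  2≢0 = FieldProperties.odd⇒2≢0 𝔽 (proj₁ (OddPrimePower⇒odd odd)) (proj₂ (OddPrimePower⇒odd odd))
  open FormProperties 𝔽 2≢0 Q isQuadraticForm using (spheres⇒radicalHyperplane)
  open RadicalHyperplaneBound 𝔽 2≢0 Q isQuadraticForm nondegenerate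
  instance
    q≢0 : NonZero q
    q≢0 = FiniteField.q≢0 𝔽
  open Bound 0<α α<1 1≤C₁ (0≤ι ∣ T ∣) (0≤ι ∣ P ∣) (ι-pos q) (ι#0 q) large (ι-* ∣ T ∣ ∣ P ∣)

  4[x2]≡8x : ∀ x → 4 ℕ.* (x ℕ.* 2) ≡ 8 ℕ.* x
  4[x2]≡8x = solve-∀

  cell≤q^[d-1] : ∀ {p p′} → p ≢ p′ → ∀ y → ∣ cell p p′ y ∣ ℕ.≤ q ℕ.^ suc n
  cell≤q^[d-1] {p} {p′} p≢p′ y = length-radicalHyperplane p≢p′ (distinct (cell p p′ y)) λ x∈ →
    let Sx , S′x = ∈-cell⁻ p p′ x∈ in spheres⇒radicalHyperplane Sx S′x

  cell≤2q^[d-2] : 1 ℕ.≤ n → ∀ {p p′} → p ≢ p′ → ∀ y → ∣ cell p p′ y ∣ ℕ.≤ q ℕ.^ n ℕ.* 2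
  cell≤2q^[d-2] 1≤n {p} {p′} p≢p′ y =
    SphereIntersectionBound.length-sphere∩sphere 𝔽 2≢0 Q isQuadraticForm nondegenerate 1≤n
      p≢p′ (distinct (cell p p′ y)) (proj₁ ∘ ∈-cell⁻ p p′) (proj₂ ∘ ∈-cell⁻ p p′)

  cell≤∣P∩H∣ : ∀ p p′ t t′ → ∣ cell p p′ (t , t′) ∣ ℕ.≤ ∣ P ∩[ H Q p t p′ t′ ] ∣
  cell≤∣P∩H∣ p p′ t t′ = subst (λ xs → length xs ℕ.≤ ∣ P ∩[ H Q p t p′ t′ ] ∣) (sym (cell≡ p p′ (t , t′)))
    (length-filter-mono _ (H Q p t p′ t′) (λ (Sx , S′x) → spheres⇒radicalHyperplane Sx S′x) (elements P))

  -- Under `ι` the integer comparison that selects heavy cells becomes the last premise of `bound≤`,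
  -- since the number of pairs of radii is the product of the numbers of radii at the two pins.
  rich : ∀ {p t p′ t′} → Admissible Q P T ((p , t) , (p′ , t′)) → HeavyAt p p′ (t , t′) →
    bound ≤ ι ∣ cell p p′ (t , t′) ∣
  rich {p} {t} {p′} {t′} (p∈T , p′∈T , _) heavy =
    bound≤ (0≤ι ∣ cell p p′ (t , t′) ∣) (0≤ι D) (0≤ι D′) (∣Δ∣≤ p p∈T) (∣Δ∣≤ p′ p′∈T)
      (≤-resp-≈ ≈-refl ι-heavy (ι-mono-≤ heavy))
    where
    open RealNumbers ℝ using (_≈_; _*_; *-congʳ; *-congˡ; reflexive)
      renaming (refl to ≈-refl; trans to ≈-trans)
    D = ∣ Δ Q p P ∣
    D′ = ∣ Δ Q p′ P ∣
    r = ∣ cell p p′ (t , t′) ∣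
    ι-heavy : ι (8 ℕ.* length (radii p p′) ℕ.* r) ≈ ι 8 * (ι D * ι D′) * ι r
    ι-heavy = ≈-trans (ι-* (8 ℕ.* length (radii p p′)) r)
      (*-congʳ (≈-trans (ι-* 8 (length (radii p p′))) (*-congˡ (≈-trans
        (reflexive (cong ι (length-cartesianProduct (elements (Δ Q p P)) (elements (Δ Q p′ P)))))
        (ι-* D D′)))))

  atLeast : ∀ {b} → b ≤ ι ∣ heavyChoices ∣ →
    AtLeast b (λ x@((p , t) , (p′ , t′)) → Admissible Q P T x × bound ≤ ι ∣ cell p p′ (t , t′) ∣)
  atLeast b≤ = heavyChoices , (λ _ x∈G →
    let admissible , heavy = ∈-heavyChoices⁻ x∈G in admissible , rich admissible heavy) , b≤
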